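{- Let $d$ be a negative integer and $e:=|d|$. Then, as formal power series in $x$, $$L_e(x,1)=\sum_{n\geq1}\frac{\displaystyle\sum_{2i_2+3i_3+\cdots+(e+1)i_{e+1}=n-1}\binom{n}{i_2,\ldots,i_{e+1}}x^{n-i_2-\cdots-i_{e+1}}\,t^{\,i_{e+1}}\prod_{j=2}^{e}\left(x\binom{e+2}{j}-\binom{e}{j-1}\right)^{i_j}}{n(1-(e+2)x)^n},$$ where the inner sum runs over nonnegative integers $i_2,\dots,i_{e+1}$ with $\sum_{j=2}^{e+1} j\,i_j=n-1$, $$\binom{n}{i_2,\ldots,i_{e+1}}=\frac{n!}{i_2!\cdots i_{e+1}!\,(n-i_2-\cdots-i_{e+1})!}\quad\text{and}\quad t=\frac{(e+2)x(1-x)-1+x(1+x)}{1-x}.$$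
   Context: A Dyck path is a lattice path in the first quadrant that starts at the origin, ends on the $x$-axis, and consists of steps $U=(1,1)$ and $D=(1,-1)$ (never going below the $x$-axis). Its semi-length is its number of $U$ steps. A valley is an occurrence of two consecutive steps $DU$; the level of a valley is the $y$-coordinate of its lowest point. Let $\nu=(\nu_1,\dots,\nu_k)$ be the levels of all valleys of $P$, listed from left to right. For $d\in\mathbb Z$, a Dyck path is called $d$-Dyck if it has at most one valley or if $\nu_{i+1}-\nu_i\ge d$ for all $1\le i<k$. For $d<0$ and $e=|d|$, $L_e(x,1)=\sum_{n\ge 1}r_d(n)x^n$, where $r_d(n)$ is the number of $d$-Dyck paths of semi-length $n$ (the empty path is not counted). -}

module Defs where

open import Data.Integer.Base as ℤ using (ℤ)
open import Data.List.Base
  using (List; []; _∷_; foldr; map; applyUpTo; upTo; filter; length; cartesianProductWith)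
open import Data.List.Relation.Unary.All using (All; []; _∷_)
open import Data.List.Relation.Unary.Linked using (Linked; linked?)
open import Data.Nat.Base as ℕ using (ℕ; zero; suc; _∸_; _!)
open import Data.Nat.Combinatorics using (_C_)
open import Data.Nat.ListAction using (sum; product)
open import Data.Nat.ListAction.Properties using (product≢0)
import Data.Nat.Properties as ℕ
open import Data.Product.Base using (_×_; ∃-syntax)
open import Data.Rational.Base as ℚ using (ℚ; 0ℚ; 1ℚ)
import Data.Integer.Properties as ℤ
import Data.Rational.Properties as ℚ
open import Data.Vec.Base using (Vec; []; _∷_; toList)
open import Relation.Binary.PropositionalEquality
open import Relation.Nullary using (yes; no)
open import Relation.Nullary.Decidable using (map′; _×-dec_)
open import Relation.Unary using (Decidable)

------------------------------------------------------------------------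
-- Finite enumerations

-- a, a+1, …, b (empty when b < a).
_⋯_ : ℕ → ℕ → List ℕ
a ⋯ b = applyUpTo (a ℕ.+_) (suc b ∸ a)

-- All m-tuples with entries drawn from a list.
tuples : ∀ {A : Set} → List A → (m : ℕ) → List (Vec A m)
tuples as zero    = [] ∷ []
tuples as (suc m) = cartesianProductWith _∷_ as (tuples as m)

------------------------------------------------------------------------
-- Dyck paths

data Step : Set where
  U D : Step

-- Dyck h p: started at height h, the path p never goes below the x-axis
-- and ends on it.
data Dyck : ℕ → List Step → Set where
  done : Dyck 0 []
  up   : ∀ {h p} → Dyck (suc h) p → Dyck h (U ∷ p)
  down : ∀ {h p} → Dyck h p → Dyck (suc h) (D ∷ p)

semilength : List Step → ℕ
semilength []      = 0
semilength (U ∷ p) = suc (semilength p)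
semilength (D ∷ p) = semilength p

-- Levels of the valleys DU, from left to right, of a path started at the
-- given height.
valleyLevels : ℤ → List Step → List ℤ
valleyLevels h []              = []
valleyLevels h (U ∷ p)         = valleyLevels (ℤ.suc h) p
valleyLevels h (D ∷ [])        = []
valleyLevels h (D ∷ p@(U ∷ _)) = ℤ.pred h ∷ valleyLevels (ℤ.pred h) p
valleyLevels h (D ∷ p@(D ∷ _)) = valleyLevels (ℤ.pred h) p

-- Linked holds vacuously for lists with at most one element, which covers
-- the paths with at most one valley.
GapsAtLeast : ℤ → List Step → Set
GapsAtLeast d p = Linked (λ ν ν′ → d ℤ.≤ ν′ ℤ.- ν) (valleyLevels ℤ.0ℤ p)

IsDDyck : ℤ → ℕ → List Step → Set
IsDDyck d n p = Dyck 0 p × semilength p ≡ n × GapsAtLeast d p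

dyck? : ∀ h → Decidable (Dyck h)
dyck? zero    []      = yes done
dyck? (suc h) []      = no λ ()
dyck? h       (U ∷ p) = map′ up (λ { (up q) → q }) (dyck? (suc h) p)
dyck? zero    (D ∷ p) = no λ ()
dyck? (suc h) (D ∷ p) = map′ down (λ { (down q) → q }) (dyck? h p)

isDDyck? : ∀ d n → Decidable (IsDDyck d n)
isDDyck? d n p =
  dyck? 0 p ×-dec semilength p ℕ.≟ n ×-dec
  linked? (λ ν ν′ → d ℤ.≤? ν′ ℤ.- ν) (valleyLevels ℤ.0ℤ p)

-- A Dyck path has as many D steps as U steps, so those of semi-length n all
-- occur among the words of length 2n.
r : ℤ → ℕ → ℕ
r d n = length (filter (isDDyck? d n) (map toList (tuples (U ∷ D ∷ []) (2 ℕ.* n))))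

------------------------------------------------------------------------
-- Formal power series over ℚ, as coefficient sequences

FPS : Set
FPS = ℕ → ℚ

fromℕ : ℕ → ℚ
fromℕ n = ℤ.+ n ℚ./ 1

const : ℕ → FPS
const c zero    = fromℕ c
const c (suc _) = 0ℚ

X : FPS
X 1 = 1ℚ
X _ = 0ℚ

infixl 6 _⊕_ _⊖_
infixl 7 _⊗_ _⊘_
infixr 8 _^_

_⊕_ _⊖_ _⊗_ : FPS → FPS → FPS
(f ⊕ g) n = f n ℚ.+ g n
(f ⊖ g) n = f n ℚ.- g n
(f ⊗ g) n = foldr ℚ._+_ 0ℚ (applyUpTo (λ k → f k ℚ.* g (n ∸ k)) (suc n))

_^_ : FPS → ℕ → FPS
f ^ zero  = const 1
f ^ suc n = f ⊗ f ^ n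

-- Long division.
_⊘_ : (f g : FPS) .{{_ : ℚ.NonZero (g 0)}} → FPS
(f ⊘ g) zero    = f 0 ℚ.÷ g 0
(f ⊘ g) (suc n) = ((λ m → f (suc m) ℚ.- (f 0 ℚ.÷ g 0) ℚ.* g (suc m)) ⊘ g) n

∑ ∏ : List FPS → FPS
∑ = foldr _⊕_ (const 0)
∏ = foldr _⊗_ (const 1)

-- Convergence of T 0 ⊕ T 1 ⊕ ⋯ to F: every coefficient of the partial sums
-- is eventually constant, equal to that of F.
_SumsTo_ : (ℕ → FPS) → FPS → Set
T SumsTo F = ∀ m → ∃[ N ] (∀ M → N ℕ.≤ M → ∑ (applyUpTo T M) m ≡ F m)

⊘-⊗ : ∀ f g .{{_ : ℚ.NonZero (g 0)}} → (f ⊘ g) ⊗ g ≗ f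
⊘-⊗ f g zero = begin
  (f 0 ℚ.* ℚ.1/ g 0) ℚ.* g 0 ℚ.+ 0ℚ  ≡⟨ ℚ.+-identityʳ _ ⟩
  (f 0 ℚ.* ℚ.1/ g 0) ℚ.* g 0         ≡⟨ ℚ.*-assoc (f 0) _ (g 0) ⟩
  f 0 ℚ.* (ℚ.1/ g 0 ℚ.* g 0)         ≡⟨ cong (f 0 ℚ.*_) (ℚ.*-inverseˡ (g 0)) ⟩
  f 0 ℚ.* 1ℚ                         ≡⟨ ℚ.*-identityʳ (f 0) ⟩
  f 0                                ∎
  where open ≡-Reasoning
⊘-⊗ f g (suc n) = begin
  a ℚ.+ (f′ ⊘ g ⊗ g) n         ≡⟨ cong (a ℚ.+_) (⊘-⊗ f′ g n) ⟩
  a ℚ.+ (f (suc n) ℚ.- a)      ≡⟨ ℚ.+-comm a _ ⟩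
  f (suc n) ℚ.- a ℚ.+ a        ≡⟨ ℚ.+-assoc (f (suc n)) _ a ⟩
  f (suc n) ℚ.+ (ℚ.- a ℚ.+ a)  ≡⟨ cong (f (suc n) ℚ.+_) (ℚ.+-inverseˡ a) ⟩
  f (suc n) ℚ.+ 0ℚ             ≡⟨ ℚ.+-identityʳ _ ⟩
  f (suc n)                    ∎
  where
  open ≡-Reasoning
  a : ℚ
  a = (f 0 ℚ.÷ g 0) ℚ.* g (suc n)
  f′ : FPS
  f′ m = f (suc m) ℚ.- (f 0 ℚ.÷ g 0) ℚ.* g (suc m)

------------------------------------------------------------------------
-- The two sides of the identity

L : ℤ → FPS
L d zero      = 0ℚ
L d n@(suc _) = fromℕ (r d n)

-- n ! / (k₁ ! ⋯ kₘ ! (n - k₁ - ⋯ - kₘ) !)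
multinomial : ℕ → List ℕ → ℕ
multinomial n ks =
  (n ! ℕ./ product (map _! (n ∸ sum ks ∷ ks))) {{product≢0 (all!≢0 (n ∸ sum ks ∷ ks))}}
  where
  all!≢0 : ∀ ms → All ℕ.NonZero (map _! ms)
  all!≢0 []       = []
  all!≢0 (m ∷ ms) = (m ℕ.!≢0) ∷ all!≢0 ms

-- A vector of length e stands for (i₂, …, i_{e+1}), and i ⟨ j ⟩ is i_j; the
-- value outside 2 ≤ j ≤ e+1 is irrelevant.
_⟨_⟩ : ∀ {e} → Vec ℕ e → ℕ → ℕ
[]      ⟨ _ ⟩                 = 0
(k ∷ i) ⟨ suc (suc (suc j)) ⟩ = i ⟨ suc (suc j) ⟩
(k ∷ i) ⟨ _ ⟩                 = k

weight : ∀ {e} → Vec ℕ e → ℕ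
weight {e} i = sum (map (λ j → j ℕ.* i ⟨ j ⟩) (2 ⋯ suc e))

-- Tuples of weight n - 1.  For n ≥ 1 each entry of such a tuple is at most
-- n - 1, so drawing the entries from 0, …, n - 1 loses none.
indices : (e n : ℕ) → List (Vec ℕ e)
indices e n = filter (λ i → weight i ℕ.≟ n ∸ 1) (tuples (upTo n) e)

t : ℕ → FPS
t e = (const (e ℕ.+ 2) ⊗ X ⊗ (const 1 ⊖ X) ⊖ const 1 ⊕ X ⊗ (const 1 ⊕ X))
      ⊘ (const 1 ⊖ X)

term : ∀ {e} → ℕ → Vec ℕ e → FPS
term {e} n i =
  const (multinomial n (toList i))
  ⊗ X ^ (n ∸ sum (toList i))
  ⊗ t e ^ (i ⟨ suc e ⟩)
  ⊗ ∏ (map (λ j → (X ⊗ const ((e ℕ.+ 2) C j) ⊖ const (e C (j ∸ 1))) ^ (i ⟨ j ⟩)) (2 ⋯ e))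

numerator : (e n : ℕ) → FPS
numerator e n = ∑ (map (term n) (indices e n))

denominator : (e n : ℕ) → FPS
denominator e n = const n ⊗ (const 1 ⊖ const (e ℕ.+ 2) ⊗ X) ^ n

denominator-nonZero : ∀ e n .{{_ : ℕ.NonZero n}} → ℚ.NonZero (denominator e n 0)
denominator-nonZero e n@(suc _) =
  subst ℚ.NonZero (sym eq) (ℚ.pos⇒nonZero (fromℕ n) {{ℚ.normalize-pos n 1}})
  where
  open ≡-Reasoning
  b : FPS
  b = const 1 ⊖ const (e ℕ.+ 2) ⊗ X
  ⊗-0 : ∀ f g → (f ⊗ g) 0 ≡ f 0 ℚ.* g 0
  ⊗-0 f g = ℚ.+-identityʳ (f 0 ℚ.* g 0)
  b-0 : b 0 ≡ 1ℚ
  b-0 = cong (λ q → 1ℚ ℚ.- q)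
    (trans (⊗-0 (const (e ℕ.+ 2)) X) (ℚ.*-zeroʳ (fromℕ (e ℕ.+ 2))))
  b^k-0 : ∀ k → (b ^ k) 0 ≡ 1ℚ
  b^k-0 zero    = refl
  b^k-0 (suc k) = trans (⊗-0 b (b ^ k)) (cong₂ ℚ._*_ b-0 (b^k-0 k))
  eq : denominator e n 0 ≡ fromℕ n
  eq = begin
    denominator e n 0      ≡⟨ ⊗-0 (const n) (b ^ n) ⟩
    fromℕ n ℚ.* (b ^ n) 0  ≡⟨ cong (fromℕ n ℚ.*_) (b^k-0 n) ⟩
    fromℕ n ℚ.* 1ℚ         ≡⟨ ℚ.*-identityʳ (fromℕ n) ⟩
    fromℕ n                ∎

summand : (e n : ℕ) .{{_ : ℕ.NonZero n}} → FPS
summand e n = (numerator e n ⊘ denominator e n) {{denominator-nonZero e n}}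

{-# OPTIONS --safe #-}
module Submission where

-- Write x for the variable, e = |d|, and let paths be weighted by their
-- semi-length. Every nonempty Dyck path is uniquely P U Q D, where P is the
-- part before its last component. Here P is followed by a U step, which creates
-- a valley on the x-axis unless P is empty; so P U Q D is a d-Dyck path if and
-- only if P and Q are and the last valley of P, if any, has level at most e.
-- Let E count these P, A count all d-Dyck paths, and Z k count those whose last
-- valley, if any, has level less than k, the empty path being included in each
-- case. Then
--   A = 1 + x E A,   Z (k + 1) = 1 + x E Z k,   Z 0 = 1 / (1 - x),
--   E = 1 + x E (Z e).
-- With ℓ = x E A = A - 1, elimination of E and Z gives
--   ℓ Aᵉ = x Aᵉ⁺² - x ℓᵉ⁺² + x² ℓᵉ⁺¹ / (1 - x)          (functional-equation),
-- and expansion by the binomial theorem turns this into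
--   (1 - (e + 2) x) ℓ = x + ∑ (x C(e+2,j) - C(e,j-1)) ℓʲ + t ℓᵉ⁺¹   (expand),
-- the sum being over 2 ≤ j ≤ e. Thus ℓ = φ(ℓ) for a polynomial φ without
-- linear term, and the claim is Lagrange inversion, ℓ = ∑ [yⁿ⁻¹] φⁿ / n,
-- combined with the multinomial theorem for φⁿ (numerator≈coeff, summand-eq).
--
-- The equations for the generating functions are not proved by a bijection.
-- A word is read from right to left by an automaton whose state records the
-- height and a bound for the next valley to be met. The numbers of words
-- accepted from the states satisfy a linear recursion that determines them,
-- and explicit products of powers of E with A or Z k satisfy it too (gf-eq,
-- extensions-gf).
--
-- Lagrange inversion is proved directly for ℓ = φ(ℓ) (inversion). The
-- functional Λ g = ∑ [yⁿ] g φⁿ sends y h and φ h to the same value, by a shift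
-- of the summation index; as φ - ℓ = (y - ℓ) c with c of positive order, it
-- follows that Λ (y h) = ℓ Λ h. The sum of the terms [yⁿ⁻¹] φⁿ / n is
-- Λ (y (1 - φ′)), and Λ (1 - φ′) = 1 because it telescopes. Convergence is
-- controlled by the order for which x counts 2 and y counts 1: φ then has
-- order 2, so that [yⁿ] φⁿ has order at least n in the weight of x, and all
-- sums can be cut off modulo terms of high order.

open import Defs
open import Data.Nat.Base using (suc)
open import Data.Integer.Base using (ℤ; 0ℤ; _<_; ∣_∣)
open import Algebra.Bundles using (CommutativeRing)
import Algebra.Construct.Pointwise as Pointwise
import Algebra.Properties.AbelianGroup as AbelianGroupProperties
import Algebra.Properties.CommutativeMonoid.Mult as CommutativeMonoidMult
import Algebra.Properties.CommutativeSemigroup as CommutativeSemigroup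
import Algebra.Properties.CommutativeSemiring.Binomial as Binomial
import Algebra.Properties.CommutativeSemiring.Exp as CommutativeExp
import Algebra.Properties.Semiring.Exp as Exp
import Algebra.Properties.Semiring.Mult as Mult
import Algebra.Properties.Semiring.Sum as Sum
import Algebra.Solver.Ring.NaturalCoefficients.Default as Solver
open import Data.Bool.Base using (Bool; true; false; T; if_then_else_)
open import Data.Bool.Properties using (T?; T-≡)
open import Data.Fin.Base using (toℕ)
open import Data.Integer.Base as ℤ using (-[1+_])
import Data.Integer.Properties as ℤ
open import Data.List.Base using (List; []; _∷_; _++_; _∷ʳ_; map; foldr; length; filter; applyUpTo; upTo; cartesianProductWith)
open import Data.List.Properties using (filter-++; length-++; map-++; map-∘; map-upTo; map-applyUpTo; ++-identityʳ)
import Data.List.Relation.Unary.All as All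
import Data.List.Relation.Unary.All.Properties as All
open import Data.List.Relation.Unary.Linked as Linked using (Linked; []; [-]; _∷_)
open import Data.Maybe.Base using (Maybe; just; nothing; _>>=_)
open import Data.Nat.Base as ℕ using (ℕ; zero; _∸_; _≤_; z≤n; s≤s; _!)
open import Data.Nat.Combinatorics using (_C_; k>n⇒nCk≡0; nCk≡n!/k![n-k]!; k![n∸k]!∣n!; nCn≡1; nC1≡n; nCk≡nC[n∸k])
open import Data.Nat.DivMod using (m*n/n≡m; m/n*n≡m)
open import Data.Nat.ListAction using (sum; product)
open import Data.Nat.ListAction.Properties using (product≢0)
import Data.Nat.Properties as ℕ
open import Data.Product.Base using (Σ; _,_; ∃-syntax; _×_; proj₁; proj₂)
open import Data.Rational.Base as ℚ using (ℚ; 0ℚ; 1ℚ)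
import Data.Rational.Properties as ℚ
import Data.Rational.Unnormalised.Base as ℚᵘ
import Data.Rational.Unnormalised.Properties as ℚᵘ
open import Data.Unit.Base using (⊤; tt)
open import Data.Vec.Base using (Vec; []; _∷_; toList)
open import Function.Base using (_∘_)
open import Function.Bundles using (Equivalence; mk⇔)
open import Level using (0ℓ)
import Relation.Binary.PropositionalEquality as ≡
import Relation.Binary.Reasoning.Setoid as SetoidReasoning
open import Relation.Nullary using (Dec; does; yes; no; contradiction)
open import Relation.Nullary.Decidable using (does-⇔)
open import Relation.Unary using (Pred; Decidable)

-- Power series over a ring, and their order

-- Formal power series over R in the variable y, as coefficient sequences
-- under pointwise equality.
module Series (R : CommutativeRing 0ℓ 0ℓ) where
  open CommutativeRing R hiding (zero)
  open SetoidReasoning setoid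
  open Solver commutativeSemiring using (solve; _:=_; _:+_; _:*_; con)

  infix  4 _≋_
  infixl 7 _·_

  _≋_ : (f g : ℕ → Carrier) → Set
  f ≋ g = ∀ n → f n ≈ g n

  -- The Cauchy product, unfolding to
  -- (f · g) (suc n) = f 0 * g (suc n) + (tail f · g) n.
  _·_ : (f g : ℕ → Carrier) → ℕ → Carrier
  (f · g) n = foldr _+_ 0# (applyUpTo (λ k → f k * g (n ∸ k)) (suc n))

  tail : (ℕ → Carrier) → ℕ → Carrier
  tail f n = f (suc n)

  -- The constant series.
  κ : Carrier → ℕ → Carrier
  κ a zero    = a
  κ a (suc _) = 0#

  -- Multiplication by the variable.
  shift : (ℕ → Carrier) → ℕ → Carrier
  shift f zero    = 0#
  shift f (suc n) = f n

  private
    zero-· : ∀ g n → ((λ _ → 0#) · g) n ≈ 0#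
    zero-· g zero    = trans (+-identityʳ _) (zeroˡ _)
    zero-· g (suc n) = trans (+-cong (zeroˡ _) (zero-· g n)) (+-identityˡ 0#)

  ·-head : ∀ f g → (f · g) 0 ≈ f 0 * g 0
  ·-head f g = +-identityʳ _

  -- Only the coefficients up to n matter for the n-th coefficient of a product.
  ·-cong-≤ : ∀ {f f′ g g′} n → (∀ k → k ≤ n → f k ≈ f′ k) →
             (∀ k → k ≤ n → g k ≈ g′ k) → (f · g) n ≈ (f′ · g′) n
  ·-cong-≤ zero    p q = +-congʳ (*-cong (p 0 z≤n) (q 0 z≤n))
  ·-cong-≤ (suc n) p q = +-cong (*-cong (p 0 z≤n) (q (suc n) ℕ.≤-refl))
    (·-cong-≤ n (λ k k≤n → p (suc k) (s≤s k≤n)) (λ k k≤n → q k (ℕ.m≤n⇒m≤1+n k≤n)))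

  ·-cong : ∀ {f f′ g g′} → f ≋ f′ → g ≋ g′ → f · g ≋ f′ · g′
  ·-cong p q n = ·-cong-≤ n (λ k _ → p k) (λ k _ → q k)

  ·-congʳ : ∀ h {f g} → f ≋ g → f · h ≋ g · h
  ·-congʳ h p = ·-cong {g = h} {g′ = h} p (λ _ → refl)

  ·-congˡ : ∀ h {f g} → f ≋ g → h · f ≋ h · g
  ·-congˡ h p = ·-cong {f = h} {f′ = h} (λ _ → refl) p

  ·-distribʳ : ∀ h f g → (λ n → f n + g n) · h ≋ (λ n → (f · h) n + (g · h) n)
  ·-distribʳ h f g zero = begin
    (f 0 + g 0) * h 0 + 0#                    ≈⟨ solve 3 (λ a b c → (a :+ b) :* c :+ con 0 := (a :* c :+ con 0) :+ (b :* c :+ con 0)) refl _ _ _ ⟩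
    (f 0 * h 0 + 0#) + (g 0 * h 0 + 0#)       ∎
  ·-distribʳ h f g (suc n) = begin
    (f 0 + g 0) * h (suc n) + ((λ n → f (suc n) + g (suc n)) · h) n
      ≈⟨ +-congˡ (·-distribʳ h (tail f) (tail g) n) ⟩
    (f 0 + g 0) * h (suc n) + ((tail f · h) n + (tail g · h) n)
      ≈⟨ solve 5 (λ a b c d e → (a :+ b) :* c :+ (d :+ e) := (a :* c :+ d) :+ (b :* c :+ e)) refl _ _ _ _ _ ⟩
    (f 0 * h (suc n) + (tail f · h) n) + (g 0 * h (suc n) + (tail g · h) n) ∎

  *-· : ∀ a f g → (λ n → a * f n) · g ≋ (λ n → a * (f · g) n)
  *-· a f g zero = solve 3 (λ a b c → a :* b :* c :+ con 0 := a :* (b :* c :+ con 0)) refl _ _ _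
  *-· a f g (suc n) = begin
    a * f 0 * g (suc n) + ((λ n → a * f (suc n)) · g) n  ≈⟨ +-congˡ (*-· a (tail f) g n) ⟩
    a * f 0 * g (suc n) + a * (tail f · g) n
      ≈⟨ solve 4 (λ a b c d → a :* b :* c :+ a :* d := a :* (b :* c :+ d)) refl _ _ _ _ ⟩
    a * (f 0 * g (suc n) + (tail f · g) n)               ∎

  ·-assoc : ∀ f g h → (f · g) · h ≋ f · (g · h)
  ·-assoc f g h zero = solve 3 (λ a b c → (a :* b :+ con 0) :* c :+ con 0 := a :* (b :* c :+ con 0) :+ con 0) refl _ _ _
  ·-assoc f g h (suc n) = begin
    (f · g) 0 * h (suc n) + (tail (f · g) · h) n
      ≈⟨ +-cong (*-congʳ (·-head f g)) (·-distribʳ h (λ n → f 0 * g (suc n)) (tail f · g) n) ⟩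
    f 0 * g 0 * h (suc n) + (((λ n → f 0 * g (suc n)) · h) n + ((tail f · g) · h) n)
      ≈⟨ +-congˡ (+-cong (*-· (f 0) (tail g) h n) (·-assoc (tail f) g h n)) ⟩
    f 0 * g 0 * h (suc n) + (f 0 * (tail g · h) n + (tail f · (g · h)) n)
      ≈⟨ solve 5 (λ a b c d e → a :* b :* c :+ (a :* d :+ e) := a :* (b :* c :+ d) :+ e) refl _ _ _ _ _ ⟩
    f 0 * (g 0 * h (suc n) + (tail g · h) n) + (tail f · (g · h)) n ∎

  private
    -- The product, with the terms taken from the other end.
    ·-unfoldʳ : ∀ f g n → (f · g) (suc n) ≈ f (suc n) * g 0 + (f · tail g) n
    ·-unfoldʳ f g zero    = solve 4 (λ a b c d → a :* b :+ (c :* d :+ con 0) := c :* d :+ (a :* b :+ con 0)) refl _ _ _ _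
    ·-unfoldʳ f g (suc n) = begin
      f 0 * g (suc (suc n)) + (tail f · g) (suc n)
        ≈⟨ +-congˡ (·-unfoldʳ (tail f) g n) ⟩
      f 0 * g (suc (suc n)) + (f (suc (suc n)) * g 0 + (tail f · tail g) n)
        ≈⟨ solve 3 (λ a b c → a :+ (b :+ c) := b :+ (a :+ c)) refl _ _ _ ⟩
      f (suc (suc n)) * g 0 + (f 0 * g (suc (suc n)) + (tail f · tail g) n) ∎

  ·-comm : ∀ f g → f · g ≋ g · f
  ·-comm f g zero    = +-congʳ (*-comm _ _)
  ·-comm f g (suc n) = begin
    f 0 * g (suc n) + (tail f · g) n  ≈⟨ +-cong (*-comm _ _) (·-comm (tail f) g n) ⟩
    g (suc n) * f 0 + (g · tail f) n  ≈⟨ ·-unfoldʳ g f n ⟨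
    (g · f) (suc n)                   ∎

  κ-· : ∀ a f → κ a · f ≋ (λ n → a * f n)
  κ-· a f zero    = +-identityʳ _
  κ-· a f (suc n) = trans (+-congˡ (zero-· f n)) (+-identityʳ _)

  shift-· : ∀ f g → shift f · g ≋ shift (f · g)
  shift-· f g zero    = trans (+-identityʳ _) (zeroˡ _)
  shift-· f g (suc n) = trans (+-congʳ (zeroˡ _)) (+-identityˡ _)

  shift-cong : ∀ {f g} → f ≋ g → shift f ≋ shift g
  shift-cong p zero    = refl
  shift-cong p (suc n) = p n

  seriesRing : CommutativeRing 0ℓ 0ℓ
  seriesRing = record
    { Carrier = ℕ → Carrier
    ; _≈_ = _≋_
    ; _+_ = λ f g n → f n + g n
    ; _*_ = _·_
    ; -_ = λ f n → - f n
    ; 0# = λ _ → 0#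
    ; 1# = κ 1#
    ; isCommutativeRing = record
      { isRing = record
        { +-isAbelianGroup = Pointwise.isAbelianGroup ℕ +-isAbelianGroup
        ; *-cong = ·-cong
        ; *-assoc = ·-assoc
        ; *-identity = identityˡ , λ f n → trans (·-comm f (κ 1#) n) (identityˡ f n)
        ; distrib = (λ f g h n → trans (·-comm f (λ n → g n + h n) n)
                       (trans (·-distribʳ f g h n) (+-cong (·-comm g f n) (·-comm h f n))))
                  , ·-distribʳ
        }
      ; *-comm = ·-comm
      }
    }
    where
    identityˡ : ∀ f → κ 1# · f ≋ f
    identityˡ f n = trans (κ-· 1# f n) (*-identityˡ (f n))

  y : ℕ → Carrier
  y = shift (κ 1#)

  y-· : ∀ f → y · f ≋ shift f
  y-· f n = trans (shift-· (κ 1#) f n) (shift-cong (CommutativeRing.*-identityˡ seriesRing f) n)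

  private module S = CommutativeRing seriesRing
  open Mult semiring using (×-comm-*; ×-congʳ) renaming (_×_ to _×ᵣ_)
  open CommutativeMonoidMult +-commutativeMonoid using (×-distrib-+)
  open Mult S.semiring using () renaming (_×_ to _×ₛ_; ×-congʳ to ×ₛ-congʳ; ×-comm-* to ×ₛ-comm-·)
  open Exp S.semiring using () renaming (_^_ to _^ₛ_)

  ×ₛ-coeff : ∀ m f n → (m ×ₛ f) n ≈ m ×ᵣ f n
  ×ₛ-coeff zero    f n = refl
  ×ₛ-coeff (suc m) f n = +-congˡ (×ₛ-coeff m f n)

  -- The Euler operator y d/dy; tail (θ f) is the derivative of f.
  θ : (ℕ → Carrier) → ℕ → Carrier
  θ f n = n ×ᵣ f n

  θ-shift-tail : ∀ f → shift (tail (θ f)) ≋ θ f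
  θ-shift-tail f zero    = refl
  θ-shift-tail f (suc n) = refl

  θ-· : ∀ f g n → θ (f · g) n ≈ (θ f · g) n + (f · θ g) n
  θ-· f g zero    = solve 2 (λ a b → con 0 := (con 0 :* b :+ con 0) :+ (a :* con 0 :+ con 0)) refl (f 0) (g 0)
  θ-· f g (suc n) = begin
    suc n ×ᵣ (f 0 * g (suc n) + (tail f · g) n)
      ≈⟨ ×-distrib-+ _ _ (suc n) ⟩
    suc n ×ᵣ (f 0 * g (suc n)) + ((tail f · g) n + n ×ᵣ (tail f · g) n)
      ≈⟨ +-cong (sym (×-comm-* (suc n) (f 0) (g (suc n)))) (+-congˡ (θ-· (tail f) g n)) ⟩
    f 0 * θ g (suc n) + ((tail f · g) n + ((θ (tail f) · g) n + (tail f · θ g) n))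
      ≈⟨ solve 5 (λ a b c d e → b :+ (c :+ (d :+ e)) := (con 0 :* a :+ (c :+ d)) :+ (b :+ e)) refl (g (suc n)) _ _ _ _ ⟩
    (0# * g (suc n) + ((tail f · g) n + (θ (tail f) · g) n)) + (f 0 * θ g (suc n) + (tail f · θ g) n)
      ≈⟨ +-congʳ (+-congˡ (·-distribʳ g (tail f) (θ (tail f)) n)) ⟨
    (θ f · g) (suc n) + (f · θ g) (suc n) ∎

  θ-^ : ∀ f n k → θ (f ^ₛ suc n) k ≈ suc n ×ᵣ (θ f · f ^ₛ n) k
  θ-^ f zero    k = begin
    θ (f · κ 1#) k                       ≈⟨ ×-congʳ k (S.*-identityʳ f k) ⟩
    θ f k                                ≈⟨ S.*-identityʳ (θ f) k ⟨
    (θ f · κ 1#) k                       ≈⟨ +-identityʳ _ ⟨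
    1 ×ᵣ (θ f · κ 1#) k                   ∎
  θ-^ f (suc n) k = begin
    θ (f · f ^ₛ suc n) k                                ≈⟨ θ-· f (f ^ₛ suc n) k ⟩
    (θ f · f ^ₛ suc n) k + (f · θ (f ^ₛ suc n)) k        ≈⟨ +-congˡ (·-congˡ f (λ i → trans (θ-^ f n i) (sym (×ₛ-coeff (suc n) (θ f · f ^ₛ n) i))) k) ⟩
    (θ f · f ^ₛ suc n) k + (f · (suc n ×ₛ (θ f · f ^ₛ n))) k  ≈⟨ +-congˡ (×ₛ-comm-· (suc n) f (θ f · f ^ₛ n) k) ⟩
    (θ f · f ^ₛ suc n) k + (suc n ×ₛ (f · (θ f · f ^ₛ n))) k  ≈⟨ +-congˡ (×ₛ-congʳ (suc n) (swap f (θ f) (f ^ₛ n)) k) ⟩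
    (θ f · f ^ₛ suc n) k + (suc n ×ₛ (θ f · f ^ₛ suc n)) k  ≈⟨ +-congˡ (×ₛ-coeff (suc n) (θ f · f ^ₛ suc n) k) ⟩
    suc (suc n) ×ᵣ (θ f · f ^ₛ suc n) k                  ∎
    where
    swap : ∀ a b c → a · (b · c) ≋ b · (a · c)
    swap a b c = S.trans (S.sym (S.*-assoc a b c)) (S.trans (S.*-congʳ (S.*-comm a b)) (S.*-assoc b a c))

-- A multiplicative filtration of R by additive submonoids I k: think of I k
-- as the elements of order at least k.
record Filtration (R : CommutativeRing 0ℓ 0ℓ) : Set₁ where
  open CommutativeRing R
  field
    I      : ℕ → Carrier → Set
    I-resp : ∀ {k a b} → a ≈ b → I k a → I k b
    I-all  : ∀ a → I 0 a
    I-mono : ∀ {k l a} → k ≤ l → I l a → I k a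
    I-0#   : ∀ k → I k 0#
    I-+    : ∀ {k a b} → I k a → I k b → I k (a + b)
    I-*    : ∀ {k l a b} → I k a → I l b → I (k ℕ.+ l) (a * b)

-- Every element has order 0, and only 0# has positive order.
trivialFiltration : (R : CommutativeRing 0ℓ 0ℓ) → Filtration R
trivialFiltration R = record
  { I = I
  ; I-resp = λ {k} → resp k
  ; I-all = λ _ → tt
  ; I-mono = mono
  ; I-0# = λ { zero → tt ; (suc _) → refl }
  ; I-+ = λ { {zero} p q → tt ; {suc _} p q → trans (+-cong p q) (+-identityˡ 0#) }
  ; I-* = λ {k} {l} → mul k l
  }
  where
  open CommutativeRing R hiding (zero)
  I : ℕ → Carrier → Set
  I zero    a = ⊤
  I (suc _) a = a ≈ 0#
  resp : ∀ k {a b} → a ≈ b → I k a → I k b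
  resp zero    _ _ = tt
  resp (suc _) p q = trans (sym p) q
  mono : ∀ {k l a} → k ≤ l → I l a → I k a
  mono z≤n     _ = tt
  mono (s≤s _) p = p
  mul : ∀ k l {a b} → I k a → I l b → I (k ℕ.+ l) (a * b)
  mul zero    zero    _ _ = tt
  mul zero    (suc _) _ q = trans (*-congˡ q) (zeroʳ _)
  mul (suc _) _       p _ = trans (*-congʳ p) (zeroˡ _)

-- The filtration of the power series over R in which the variable has
-- order w.
seriesFiltration : ∀ {R} → ℕ → Filtration R → Filtration (Series.seriesRing R)
seriesFiltration {R} w F = record
  { I = J
  ; I-resp = λ p q n → I-resp (p n) (q n)
  ; I-all = λ f n → I-mono (ℕ.≤-reflexive (ℕ.0∸n≡0 (n ℕ.* w))) (I-all (f n))
  ; I-mono = λ k≤l p n → I-mono (ℕ.∸-monoˡ-≤ (n ℕ.* w) k≤l) (p n)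
  ; I-0# = λ k n → I-0# (k ∸ n ℕ.* w)
  ; I-+ = λ p q n → I-+ (p n) (q n)
  ; I-* = λ {k} {l} p q n → J-· {k} {l} p q n
  }
  where
  open Series R
  open Filtration F
  open CommutativeRing R hiding (zero)
  J : ℕ → (ℕ → Carrier) → Set
  J k f = ∀ n → I (k ∸ n ℕ.* w) (f n)
  +-∸-≤ : ∀ k l m → k ℕ.+ l ∸ m ≤ k ℕ.+ (l ∸ m)
  +-∸-≤ k l m = ℕ.m≤n+o⇒m∸n≤o (k ℕ.+ l) m
    (ℕ.≤-trans (ℕ.+-monoʳ-≤ k (ℕ.m≤n+m∸n l m))
      (ℕ.≤-reflexive (≡.trans (≡.sym (ℕ.+-assoc k m (l ∸ m)))
        (≡.trans (≡.cong (ℕ._+ (l ∸ m)) (ℕ.+-comm k m)) (ℕ.+-assoc m k (l ∸ m))))))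
  J-· : ∀ {k l f g} → J k f → J l g → J (k ℕ.+ l) (f · g)
  J-· {f = f} {g} p q zero = I-resp (sym (·-head f g)) (I-* (p 0) (q 0))
  J-· {k} {l} {f} {g} p q (suc n) = I-+
    (I-mono (+-∸-≤ k l (suc n ℕ.* w)) (I-* (p 0) (q (suc n))))
    (I-mono le (J-· {k ∸ w} {l} {tail f} {g}
      (λ m → I-mono (ℕ.≤-reflexive (ℕ.∸-+-assoc k w (m ℕ.* w))) (p (suc m))) q n))
    where
    le : k ℕ.+ l ∸ (w ℕ.+ n ℕ.* w) ≤ k ∸ w ℕ.+ l ∸ n ℕ.* w
    le = ℕ.≤-trans (ℕ.≤-reflexive (≡.sym (ℕ.∸-+-assoc (k ℕ.+ l) w (n ℕ.* w))))
      (ℕ.∸-monoˡ-≤ (n ℕ.* w) (ℕ.≤-trans (ℕ.≤-reflexive (≡.cong (_∸ w) (ℕ.+-comm k l)))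
        (ℕ.≤-trans (+-∸-≤ l k w) (ℕ.≤-reflexive (ℕ.+-comm l (k ∸ w))))))

-- Sums over the indices smaller than a bound.
module RangeSum (R : CommutativeRing 0ℓ 0ℓ) where
  open CommutativeRing R hiding (zero)
  open Solver commutativeSemiring using (solve; _:=_; _:+_)

  ∑< : ℕ → (ℕ → Carrier) → Carrier
  ∑< n f = foldr _+_ 0# (applyUpTo f n)

  ∑<-cong : ∀ n {f g} → (∀ k → f k ≈ g k) → ∑< n f ≈ ∑< n g
  ∑<-cong zero    p = refl
  ∑<-cong (suc n) p = +-cong (p 0) (∑<-cong n (λ k → p (suc k)))

  ∑<-last : ∀ n f → ∑< (suc n) f ≈ ∑< n f + f n
  ∑<-last zero    f = +-comm (f 0) 0#
  ∑<-last (suc n) f = trans (+-congˡ (∑<-last n (λ k → f (suc k)))) (sym (+-assoc _ _ _))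

  ∑<-+ : ∀ n f g → ∑< n (λ k → f k + g k) ≈ ∑< n f + ∑< n g
  ∑<-+ zero    f g = sym (+-identityˡ 0#)
  ∑<-+ (suc n) f g = trans (+-congˡ (∑<-+ n (λ k → f (suc k)) (λ k → g (suc k))))
    (solve 4 (λ a b c d → (a :+ b) :+ (c :+ d) := (a :+ c) :+ (b :+ d)) refl _ _ _ _)

  *-∑< : ∀ n a f → a * ∑< n f ≈ ∑< n (λ k → a * f k)
  *-∑< zero    a f = zeroʳ a
  *-∑< (suc n) a f = trans (distribˡ a _ _) (+-congˡ (*-∑< n a (λ k → f (suc k))))

-- Lagrange inversion

-- Convergence of the sums in the inversion formula comes from a filtration of
-- R, not from an auxiliary variable. The variable y of the series over R has
-- order 1.
module Lagrange (R : CommutativeRing 0ℓ 0ℓ) (F : Filtration R) where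
  open CommutativeRing R hiding (zero)
  open SetoidReasoning setoid
  open Solver commutativeSemiring using (solve; _:=_; _:+_)
  open Mult semiring using () renaming (_×_ to _×ᵣ_; ×-congʳ to ×ᵣ-congʳ)
  open CommutativeMonoidMult +-commutativeMonoid using (×-distrib-+)
  open Series R
  open RangeSum R
  open Filtration F
  private
    module S = CommutativeRing seriesRing
    module G = Filtration (seriesFiltration 1 F)
    module SS = Solver S.commutativeSemiring
    open Exp S.semiring using () renaming (_^_ to _^ₛ_)

  -- Congruence modulo elements of order at least M, without subtraction.
  _~[_]_ : Carrier → ℕ → Carrier → Set
  a ~[ M ] b = ∃[ u ] ∃[ v ] (I M u × I M v × a + u ≈ b + v)

  module _ {M : ℕ} where

    ≈⇒~ : ∀ {a b} → a ≈ b → a ~[ M ] b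
    ≈⇒~ p = 0# , 0# , I-0# M , I-0# M , +-congʳ p

    ~-sym : ∀ {a b} → a ~[ M ] b → b ~[ M ] a
    ~-sym (u , v , p , q , e) = v , u , q , p , sym e

    ~-trans : ∀ {a b c} → a ~[ M ] b → b ~[ M ] c → a ~[ M ] c
    ~-trans {a} {b} {c} (u , v , p , q , e) (u′ , v′ , p′ , q′ , e′) =
      u + u′ , v′ + v , I-+ p p′ , I-+ q′ q , (begin
        a + (u + u′)   ≈⟨ +-assoc a u u′ ⟨
        (a + u) + u′   ≈⟨ +-congʳ e ⟩
        (b + v) + u′   ≈⟨ solve 3 (λ x y z → (x :+ y) :+ z := (x :+ z) :+ y) refl b v u′ ⟩
        (b + u′) + v   ≈⟨ +-congʳ e′ ⟩
        (c + v′) + v   ≈⟨ +-assoc c v′ v ⟩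
        c + (v′ + v)   ∎)

    ~-+ : ∀ {a b a′ b′} → a ~[ M ] b → a′ ~[ M ] b′ → (a + a′) ~[ M ] (b + b′)
    ~-+ (u , v , p , q , e) (u′ , v′ , p′ , q′ , e′) = u + u′ , v + v′ , I-+ p p′ , I-+ q q′ ,
      trans (inter _ _ _ _) (trans (+-cong e e′) (inter _ _ _ _))
      where
      inter : ∀ a b c d → (a + b) + (c + d) ≈ (a + c) + (b + d)
      inter = solve 4 (λ a b c d → (a :+ b) :+ (c :+ d) := (a :+ c) :+ (b :+ d)) refl

    ~-* : ∀ {a b} c → a ~[ M ] b → (c * a) ~[ M ] (c * b)
    ~-* c (u , v , p , q , e) = c * u , c * v , I-* (I-all c) p , I-* (I-all c) q ,
      trans (sym (distribˡ c _ _)) (trans (*-congˡ e) (distribˡ c _ _))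

    ~-cancelʳ : ∀ {a b} c → (a + c) ~[ M ] (b + c) → a ~[ M ] b
    ~-cancelʳ {a} {b} c (u , v , p , q , e) = u , v , p , q , ∙-cancelʳ c _ _ (begin
      (a + u) + c  ≈⟨ swap a u c ⟩
      (a + c) + u  ≈⟨ e ⟩
      (b + c) + v  ≈⟨ swap b c v ⟩
      (b + v) + c  ∎)
      where
      open AbelianGroupProperties +-abelianGroup using (∙-cancelʳ)
      swap : ∀ x y z → (x + y) + z ≈ (x + z) + y
      swap = solve 3 (λ x y z → (x :+ y) :+ z := (x :+ z) :+ y) refl

    I⇒~ : ∀ {a b} → I M a → I M b → a ~[ M ] b
    I⇒~ {a} {b} p q = b , a , q , p , +-comm a b

  I-∑< : ∀ {k} n {f} → (∀ i → I k (f i)) → I k (∑< n f)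
  I-∑< {k} zero    p = I-0# k
  I-∑< {k} (suc n) p = I-+ (p 0) (I-∑< n (λ i → p (suc i)))

  -- The last hypothesis says that φ - ℓ = (y - ℓ) c.
  module Inversion
    (×-cancel : ∀ n {a b} → suc n ×ᵣ a ≈ suc n ×ᵣ b → a ≈ b)
    {φ : ℕ → Carrier} (φ∈ : G.I 2 φ)
    {ℓ : Carrier} (ℓ∈ : I 1 ℓ)
    {c : ℕ → Carrier} (c∈ : G.I 1 c)
    (φ-ℓ : φ S.+ κ ℓ · c ≋ κ ℓ S.+ y · c)
    where

    private
      φ^∈ : ∀ n → G.I (n ℕ.* 2) (φ ^ₛ n)
      φ^∈ zero    = G.I-all _
      φ^∈ (suc n) = G.I-* {a = φ} {b = φ ^ₛ n} φ∈ (φ^∈ n)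

    -- The diagonal sum of [yⁿ] g φⁿ over n < M. Up to terms of order M, it
    -- vanishes on the ideal generated by y - φ.
    Λ : ℕ → (ℕ → Carrier) → Carrier
    Λ M g = ∑< M (λ n → (g · φ ^ₛ n) n)

    Λ-cong : ∀ M {f g} → f ≋ g → Λ M f ≈ Λ M g
    Λ-cong M p = ∑<-cong M (λ n → ·-congʳ (φ ^ₛ n) p n)

    Λ-+ : ∀ M f g → Λ M (f S.+ g) ≈ Λ M f + Λ M g
    Λ-+ M f g = trans (∑<-cong M (λ n → ·-distribʳ (φ ^ₛ n) f g n)) (∑<-+ M _ _)

    Λ-κ : ∀ M a g → Λ M (κ a · g) ≈ a * Λ M g
    Λ-κ M a g = trans
      (∑<-cong M (λ n → trans (·-assoc (κ a) g (φ ^ₛ n) n) (κ-· a (g · φ ^ₛ n) n)))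
      (sym (*-∑< M a _))

    diagonal-order : ∀ {k} g n → G.I k g → I (k ℕ.+ n) ((g · φ ^ₛ n) n)
    diagonal-order {k} g n g∈ = I-mono (ℕ.≤-reflexive eq) (G.I-* {a = g} {b = φ ^ₛ n} g∈ (φ^∈ n) n)
      where
      eq : k ℕ.+ n ≡.≡ k ℕ.+ n ℕ.* 2 ∸ n ℕ.* 1
      eq = ≡.trans (≡.sym (ℕ.m+n∸n≡m (k ℕ.+ n) n)) (≡.cong₂ _∸_
        (≡.trans (ℕ.+-assoc k n n) (≡.cong (k ℕ.+_)
          (≡.trans (≡.cong (n ℕ.+_) (≡.sym (ℕ.+-identityʳ n))) (ℕ.*-comm 2 n))))
        (≡.sym (ℕ.*-identityʳ n)))

    -- The two sums differ by a shift of the summation index.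
    Λ-y~φ : ∀ M g → Λ M (y · g) ~[ M ] Λ M (φ · g)
    Λ-y~φ M g = (y · g · φ ^ₛ M) M , 0# ,
      I-mono (ℕ.m≤n+m M 0) (diagonal-order (y · g) M (G.I-all _)) , I-0# M , (begin
      Λ M (y · g) + (y · g · φ ^ₛ M) M           ≈⟨ ∑<-last M _ ⟨
      (y · g · κ 1#) 0 + ∑< M (λ n → (y · g · φ ^ₛ suc n) (suc n))
        ≈⟨ +-cong (step 0 0) (∑<-cong M (λ n → trans (step (suc n) (suc n)) (rearrange n n))) ⟩
      0# + Λ M (φ · g)                          ≈⟨ +-comm 0# _ ⟩
      Λ M (φ · g) + 0#                          ∎)
      where
      step : ∀ n k → (y · g · φ ^ₛ n) k ≈ shift (g · φ ^ₛ n) k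
      step n k = trans (·-assoc y g (φ ^ₛ n) k) (y-· (g · φ ^ₛ n) k)
      rearrange : ∀ n → g · φ ^ₛ suc n ≋ φ · g · φ ^ₛ n
      rearrange n = SS.solve 3 (λ a b c → a SS.:* (b SS.:* c) SS.:= b SS.:* a SS.:* c) (λ _ → refl) g φ (φ ^ₛ n)

    -- Modulo order M, Λ does not tell (y - ℓ) g from (φ - ℓ) g = (y - ℓ) c g,
    -- so g can be replaced by c g as often as needed to reach order M.
    Λ-y~ℓ : ∀ M g → Λ M (y · g) ~[ M ] Λ M (κ ℓ · g)
    Λ-y~ℓ M g = go M 0 g (ℕ.≤-reflexive (≡.sym (ℕ.+-identityʳ M))) (G.I-all g)
      where
      high : ∀ {k} f → G.I k f → M ≤ k → I M (Λ M f)
      high {k} f f∈ M≤k = I-∑< M (λ n → I-mono (ℕ.≤-trans M≤k (ℕ.m≤m+n k n)) (diagonal-order f n f∈))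
      go : ∀ j k g → M ≤ j ℕ.+ k → G.I k g → Λ M (y · g) ~[ M ] Λ M (κ ℓ · g)
      go zero    k g M≤k g∈ = I⇒~ (high (y · g) (G.I-* {a = y} {b = g} (G.I-all y) g∈) M≤k)
                                  (high (κ ℓ · g) (G.I-* {a = κ ℓ} {b = g} (G.I-all (κ ℓ)) g∈) M≤k)
      go (suc j) k g M≤j+k g∈ = ~-trans (Λ-y~φ M g) (~-cancelʳ (Λ M (κ ℓ · (c · g)))
        (~-trans (≈⇒~ (begin
          Λ M (φ · g) + Λ M (κ ℓ · (c · g))      ≈⟨ Λ-+ M (φ · g) (κ ℓ · (c · g)) ⟨
          Λ M (φ · g S.+ κ ℓ · (c · g))          ≈⟨ Λ-cong M (factor φ (κ ℓ) c g) ⟩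
          Λ M ((φ S.+ κ ℓ · c) · g)              ≈⟨ Λ-cong M (·-congʳ g φ-ℓ) ⟩
          Λ M ((κ ℓ S.+ y · c) · g)              ≈⟨ Λ-cong M (factor (κ ℓ) y c g) ⟨
          Λ M (κ ℓ · g S.+ y · (c · g))          ≈⟨ Λ-+ M (κ ℓ · g) (y · (c · g)) ⟩
          Λ M (κ ℓ · g) + Λ M (y · (c · g))      ∎))
        (~-+ (≈⇒~ refl) (go j (suc k) (c · g)
          (ℕ.≤-trans M≤j+k (ℕ.≤-reflexive (≡.sym (ℕ.+-suc j k)))) (G.I-* {a = c} {b = g} c∈ g∈)))))
        where
        factor : ∀ p q r s → p · s S.+ q · (r · s) ≋ (p S.+ q · r) · s
        factor = SS.solve 4 (λ p q r s → p SS.:* s SS.:+ q SS.:* (r SS.:* s) SS.:= (p SS.:+ q SS.:* r) SS.:* s) (λ _ → refl)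

    -- The derivative of φ.
    φ′ : ℕ → Carrier
    φ′ = tail (θ φ)

    -- Λ (1 - φ′) telescopes to 1 - [yᴹ] φᴹ, as [yⁿ] φ′ φⁿ = [yⁿ⁺¹] φⁿ⁺¹.
    Λ-1 : ∀ M → Λ M (κ 1#) ~[ M ] (1# + Λ M φ′)
    Λ-1 M = (φ ^ₛ M) M , 0# ,
      I-resp (S.*-identityˡ (φ ^ₛ M) M) (diagonal-order (κ 1#) M (G.I-all _)) , I-0# M , (begin
      Λ M (κ 1#) + (φ ^ₛ M) M                      ≈⟨ +-congʳ (∑<-cong M (λ n → S.*-identityˡ (φ ^ₛ n) n)) ⟩
      ∑< M (λ n → (φ ^ₛ n) n) + (φ ^ₛ M) M          ≈⟨ ∑<-last M _ ⟨
      1# + ∑< M (λ n → (φ ^ₛ suc n) (suc n))       ≈⟨ +-congˡ (∑<-cong M diagonal-derivative) ⟩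
      1# + Λ M φ′                                 ≈⟨ +-identityʳ _ ⟨
      1# + Λ M φ′ + 0#                            ∎)
      where
      diagonal-derivative : ∀ n → (φ ^ₛ suc n) (suc n) ≈ (φ′ · φ ^ₛ n) n
      diagonal-derivative n = ×-cancel n (begin
        suc n ×ᵣ (φ ^ₛ suc n) (suc n)           ≈⟨ θ-^ φ n (suc n) ⟩
        suc n ×ᵣ (θ φ · φ ^ₛ n) (suc n)         ≈⟨ ×ᵣ-congʳ (suc n) (·-congʳ (φ ^ₛ n) (λ k → sym (θ-shift-tail φ k)) (suc n)) ⟩
        suc n ×ᵣ (shift φ′ · φ ^ₛ n) (suc n)    ≈⟨ ×ᵣ-congʳ (suc n) (shift-· φ′ (φ ^ₛ n) (suc n)) ⟩
        suc n ×ᵣ (φ′ · φ ^ₛ n) n                ∎)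

    -- ℓ is the sum of the series with terms ([yᵏ] φᵏ⁺¹) / (k + 1).
    inversion : ∀ {s : ℕ → Carrier} → (∀ k → suc k ×ᵣ s k ≈ (φ ^ₛ suc k) k) →
                ∀ M → ∑< M s ~[ M ] ℓ
    inversion {s} s-eq M = ~-cancelʳ (ℓ * Λ M φ′) (~-trans lhs rhs)
      where
      -- s k = [yᵏ] (φ - y φ′) φᵏ
      s+θ : ∀ k → s k + (θ φ · φ ^ₛ k) k ≈ (φ · φ ^ₛ k) k
      s+θ k = ×-cancel k (begin
        suc k ×ᵣ (s k + (θ φ · φ ^ₛ k) k)                 ≈⟨ ×-distrib-+ _ _ (suc k) ⟩
        suc k ×ᵣ s k + suc k ×ᵣ (θ φ · φ ^ₛ k) k          ≈⟨ +-cong (s-eq k) (sym (θ-^ φ k k)) ⟩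
        suc k ×ᵣ (φ ^ₛ suc k) k                           ∎)

      Λθ : Λ M (θ φ) ~[ M ] (ℓ * Λ M φ′)
      Λθ = ~-trans (≈⇒~ (Λ-cong M (λ k → trans (sym (θ-shift-tail φ k)) (sym (y-· φ′ k)))))
                   (~-trans (Λ-y~ℓ M φ′) (≈⇒~ (Λ-κ M ℓ φ′)))

      lhs : (∑< M s + ℓ * Λ M φ′) ~[ M ] Λ M φ
      lhs = ~-trans (~-+ (≈⇒~ refl) (~-sym Λθ))
                    (≈⇒~ (trans (sym (∑<-+ M s _)) (∑<-cong M s+θ)))

      rhs : Λ M φ ~[ M ] (ℓ + ℓ * Λ M φ′)
      rhs = ~-trans (≈⇒~ (Λ-cong M (λ k → sym (S.*-identityʳ φ k))))
        (~-trans (~-sym (Λ-y~φ M (κ 1#)))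
        (~-trans (Λ-y~ℓ M (κ 1#))
        (~-trans (≈⇒~ (Λ-κ M ℓ (κ 1#)))
        (~-trans (~-* ℓ (Λ-1 M))
          (≈⇒~ (trans (distribˡ ℓ 1# _) (+-congʳ (*-identityʳ ℓ))))))))

-- The multinomial theorem

-- Sums over the members of a list.
module ListSum (R : CommutativeRing 0ℓ 0ℓ) where
  open CommutativeRing R hiding (zero)
  open RangeSum R

  ∑∈ : ∀ {A : Set} → List A → (A → Carrier) → Carrier
  ∑∈ xs f = foldr _+_ 0# (map f xs)

  module _ {A : Set} where

    ∑∈-cong : ∀ (xs : List A) {f g} → (∀ a → f a ≈ g a) → ∑∈ xs f ≈ ∑∈ xs g
    ∑∈-cong []       p = refl
    ∑∈-cong (x ∷ xs) p = +-cong (p x) (∑∈-cong xs p)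

    *-∑∈ : ∀ a (xs : List A) f → a * ∑∈ xs f ≈ ∑∈ xs (λ x → a * f x)
    *-∑∈ a []       f = zeroʳ a
    *-∑∈ a (x ∷ xs) f = trans (distribˡ a _ _) (+-congˡ (*-∑∈ a xs f))

    ∑∈-++ : ∀ (xs ys : List A) f → ∑∈ (xs ++ ys) f ≈ ∑∈ xs f + ∑∈ ys f
    ∑∈-++ []       ys f = sym (+-identityˡ _)
    ∑∈-++ (x ∷ xs) ys f = trans (+-congˡ (∑∈-++ xs ys f)) (sym (+-assoc _ _ _))

    ∑∈-filter : ∀ {P : Pred A 0ℓ} (P? : Decidable P) xs f →
                ∑∈ (filter P? xs) f ≈ ∑∈ xs (λ x → if does (P? x) then f x else 0#)
    ∑∈-filter P? []       f = refl
    ∑∈-filter P? (x ∷ xs) f with P? x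
    ... | yes _ = +-congˡ (∑∈-filter P? xs f)
    ... | no _  = trans (∑∈-filter P? xs f) (sym (+-identityˡ _))

    ∑∈-map : ∀ {B : Set} (g : B → A) xs f → ∑∈ (map g xs) f ≈ ∑∈ xs (λ x → f (g x))
    ∑∈-map g []       f = refl
    ∑∈-map g (x ∷ xs) f = +-congˡ (∑∈-map g xs f)

  ∑∈-cartesianProductWith : ∀ {A B C : Set} (g : A → B → C) xs ys f →
    ∑∈ (cartesianProductWith g xs ys) f ≈ ∑∈ xs (λ x → ∑∈ ys (λ y → f (g x y)))
  ∑∈-cartesianProductWith g []       ys f = refl
  ∑∈-cartesianProductWith g (x ∷ xs) ys f =
    trans (∑∈-++ (map (g x) ys) (cartesianProductWith g xs ys) f)
      (+-cong (∑∈-map (g x) ys f) (∑∈-cartesianProductWith g xs ys f))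

  ∑∈-upTo : ∀ n f → ∑∈ (upTo n) f ≈ ∑< n f
  ∑∈-upTo n f = reflexive (≡.cong (foldr _+_ 0#) (map-upTo f n))

module BinomialSum (R : CommutativeRing 0ℓ 0ℓ) where
  open CommutativeRing R hiding (zero)
  open RangeSum R
  open Mult semiring using () renaming (_×_ to _×ᵣ_; ×-congˡ to ×ᵣ-congˡ)
  open Exp semiring using () renaming (_^_ to _^ᵣ_)
  open Sum semiring using () renaming (sum to ∑Fin)

  ∑<-truncate : ∀ m n f → (∀ k → m ≤ k → f k ≈ 0#) → ∑< (m ℕ.+ n) f ≈ ∑< m f
  ∑<-truncate zero    zero    f p = refl
  ∑<-truncate zero    (suc n) f p = trans (+-cong (p 0 z≤n) (∑<-truncate zero n (λ k → f (suc k)) (λ k _ → p (suc k) z≤n))) (+-identityˡ 0#)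
  ∑<-truncate (suc m) n       f p = +-congˡ (∑<-truncate m n (λ k → f (suc k)) (λ k m≤k → p (suc k) (s≤s m≤k)))

  binomial : ∀ x z n → (x + z) ^ᵣ n ≈ ∑< (suc n) (λ k → (n C k) ×ᵣ (x ^ᵣ k * z ^ᵣ (n ∸ k)))
  binomial x z n = trans (Binomial.theorem commutativeSemiring n x z) (∑Fin≈∑< (suc n) (λ k → (n C k) ×ᵣ (x ^ᵣ k * z ^ᵣ (n ∸ k))))
    where
    ∑Fin≈∑< : ∀ n f → ∑Fin {n} (λ i → f (toℕ i)) ≈ ∑< n f
    ∑Fin≈∑< zero    f = refl
    ∑Fin≈∑< (suc n) f = +-congˡ (∑Fin≈∑< n (λ k → f (suc k)))

  -- The summation bound can be any number larger than n.
  binomial-≤ : ∀ x z n d → (x + z) ^ᵣ n ≈ ∑< (suc n ℕ.+ d) (λ k → (n C k) ×ᵣ (x ^ᵣ k * z ^ᵣ (n ∸ k)))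
  binomial-≤ x z n d = trans (binomial x z n) (sym (∑<-truncate (suc n) d (λ k → (n C k) ×ᵣ (x ^ᵣ k * z ^ᵣ (n ∸ k)))
    (λ k n<k → ×ᵣ-congˡ {x ^ᵣ k * z ^ᵣ (n ∸ k)} (k>n⇒nCk≡0 n<k))))

-- Polynomials, as lists of coefficients by increasing degree.
module Polynomial (R : CommutativeRing 0ℓ 0ℓ) where
  open CommutativeRing R hiding (zero)
  open Series R
  private
    module S = CommutativeRing seriesRing
    module SS = Solver S.commutativeSemiring
  open SetoidReasoning S.setoid

  -- The polynomial as a power series, by Horner's rule.
  poly : ∀ {m} → Vec Carrier m → ℕ → Carrier
  poly []       = S.0#
  poly (a ∷ as) = κ a S.+ y · poly as

  eval : ∀ {m} → Vec Carrier m → Carrier → Carrier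
  eval []       ℓ = 0#
  eval (a ∷ as) ℓ = a + ℓ * eval as ℓ

  -- The quotient of p(y) - p(ℓ) by y - ℓ.
  quotient : ∀ {m} → Vec Carrier m → Carrier → ℕ → Carrier
  quotient []       ℓ = S.0#
  quotient (a ∷ as) ℓ = poly as S.+ κ ℓ · quotient as ℓ

  κ-+ : ∀ a b → κ (a + b) ≋ κ a S.+ κ b
  κ-+ a b zero    = refl
  κ-+ a b (suc n) = sym (+-identityˡ 0#)

  κ-cong : ∀ {a b} → a ≈ b → κ a ≋ κ b
  κ-cong p zero    = p
  κ-cong p (suc n) = refl

  κ-* : ∀ a b → κ (a * b) ≋ κ a · κ b
  κ-* a b zero    = sym (κ-· a (κ b) 0)
  κ-* a b (suc n) = trans (sym (zeroʳ a)) (sym (κ-· a (κ b) (suc n)))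

  quotient-eq : ∀ {m} (as : Vec Carrier m) ℓ →
                poly as S.+ κ ℓ · quotient as ℓ ≋ κ (eval as ℓ) S.+ y · quotient as ℓ
  quotient-eq []       ℓ = begin
    S.0# S.+ κ ℓ · S.0#      ≈⟨ S.+-congˡ {S.0#} {κ ℓ · S.0#} {S.0#} (S.zeroʳ (κ ℓ)) ⟩
    S.0# S.+ S.0#            ≈⟨ S.+-cong {S.0#} {κ 0#} {S.0#} {y · S.0#} (λ { zero → refl ; (suc n) → refl }) (S.sym {y · S.0#} (S.zeroʳ y)) ⟩
    κ 0# S.+ y · S.0#        ∎
  quotient-eq (a ∷ as) ℓ = begin
    (κ a S.+ y · p) S.+ κ ℓ · (p S.+ κ ℓ · q)
      ≈⟨ S.+-congˡ {κ a S.+ y · p} (·-congˡ (κ ℓ) (quotient-eq as ℓ)) ⟩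
    (κ a S.+ y · p) S.+ κ ℓ · (κ v S.+ y · q)
      ≈⟨ SS.solve 6 (λ a y p l v q → (a SS.:+ y SS.:* p) SS.:+ l SS.:* (v SS.:+ y SS.:* q)
           SS.:= (a SS.:+ l SS.:* v) SS.:+ y SS.:* (p SS.:+ l SS.:* q)) (λ _ → refl) (κ a) y p (κ ℓ) (κ v) q ⟩
    (κ a S.+ κ ℓ · κ v) S.+ y · (p S.+ κ ℓ · q)
      ≈⟨ S.+-congʳ {y · (p S.+ κ ℓ · q)} (S.trans (κ-+ a (ℓ * v)) (S.+-congˡ {κ a} (κ-* ℓ v))) ⟨
    κ (a + ℓ * v) S.+ y · (p S.+ κ ℓ · q) ∎
    where
    p q : ℕ → Carrier
    p = poly as
    q = quotient as ℓ
    v : Carrier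
    v = eval as ℓ

-- n ! / (k₁ ! ⋯ kₘ ! (n - k₁ - ⋯ - kₘ) !) as a product of binomial
-- coefficients; it is 0 when k₁ + ⋯ + kₘ exceeds n.
multi : ℕ → List ℕ → ℕ
multi n []       = 1
multi n (k ∷ ks) = (n C k) ℕ.* multi (n ∸ k) ks

-- j i₁ + (j + 1) i₂ + ⋯
wt : ∀ {m} → ℕ → Vec ℕ m → ℕ
wt j []      = 0
wt j (k ∷ i) = j ℕ.* k ℕ.+ wt (suc j) i

-- Coefficients of the powers of a₀ + a₁ yʲ + a₂ yʲ⁺¹ + ⋯ for j ≥ 1. Names with
-- the index ₛ refer to the ring of series.
module MultinomialTheorem (R : CommutativeRing 0ℓ 0ℓ) (a₀ : CommutativeRing.Carrier R) where
  open CommutativeRing R hiding (zero)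
  open Series R
  open Polynomial R
  private
    module S = CommutativeRing seriesRing
    module SS = Solver S.commutativeSemiring
    module SM = Mult S.semiring
    module SB = BinomialSum seriesRing
  open Exp S.semiring using () renaming (_^_ to _^ₛ_; ^-homo-* to ^ₛ-homo-*; ^-assocʳ to ^ₛ-assocʳ)
  open Exp semiring using () renaming (_^_ to _^ᵣ_)
  open Mult semiring using () renaming (_×_ to _×ᵣ_)
  open RangeSum R
  open RangeSum seriesRing using () renaming (∑< to ∑<ₛ)
  open ListSum R
  open ListSum seriesRing using () renaming (∑∈ to ∑∈ₛ; *-∑∈ to *-∑∈ₛ; ∑∈-cong to ∑∈ₛ-cong)
  open SM using () renaming (_×_ to _×ₛ_)

  -- a₀ + a₁ yʲ + a₂ yʲ⁺¹ + ⋯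
  base : ∀ {m} → ℕ → Vec Carrier m → ℕ → Carrier
  base j []       = κ a₀
  base j (a ∷ as) = κ a · y ^ₛ j S.+ base (suc j) as

  -- The product of the powers of the coefficients with the given exponents,
  -- without and with the powers of y that belong to them.
  monomial : ∀ {m} → Vec Carrier m → Vec ℕ m → Carrier
  monomial []       []      = 1#
  monomial (a ∷ as) (k ∷ i) = a ^ᵣ k * monomial as i

  monomialₛ : ∀ {m} → ℕ → Vec Carrier m → Vec ℕ m → ℕ → Carrier
  monomialₛ j []       []      = S.1#
  monomialₛ j (a ∷ as) (k ∷ i) = (κ a · y ^ₛ j) ^ₛ k · monomialₛ (suc j) as i

  -- A term of the expansion of the n-th power.
  termₛ : ∀ {m} → ℕ → ℕ → Vec Carrier m → Vec ℕ m → ℕ → Carrier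
  termₛ n j as i = multi n (toList i) ×ₛ (κ a₀ ^ₛ (n ∸ sum (toList i)) · monomialₛ j as i)

  ∑<ₛ-coeff : ∀ m f n → ∑<ₛ m f n ≈ ∑< m (λ k → f k n)
  ∑<ₛ-coeff zero    f n = refl
  ∑<ₛ-coeff (suc m) f n = +-congˡ (∑<ₛ-coeff m (λ k → f (suc k)) n)

  ∑∈ₛ-coeff : ∀ {A : Set} (xs : List A) f n → ∑∈ₛ xs f n ≈ ∑∈ xs (λ k → f k n)
  ∑∈ₛ-coeff []       f n = refl
  ∑∈ₛ-coeff (x ∷ xs) f n = +-congˡ (∑∈ₛ-coeff xs f n)

  y^-low : ∀ m f n → n ℕ.< m → (y ^ₛ m · f) n ≈ 0#
  y^-low (suc m) f n n<m = trans (·-assoc y (y ^ₛ m) f n) (trans (y-· (y ^ₛ m · f) n) (low n n<m))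
    where
    low : ∀ n → n ℕ.< suc m → shift (y ^ₛ m · f) n ≈ 0#
    low zero    _         = refl
    low (suc n) (s≤s n<m) = y^-low m f n n<m

  y^-κ : ∀ m c n → (y ^ₛ m · κ c) n ≈ (if does (m ℕ.≟ n) then c else 0#)
  y^-κ zero    c zero    = S.*-identityˡ (κ c) 0
  y^-κ zero    c (suc n) = S.*-identityˡ (κ c) (suc n)
  y^-κ (suc m) c zero    = y^-low (suc m) (κ c) 0 (s≤s z≤n)
  y^-κ (suc m) c (suc n) = trans (·-assoc y (y ^ₛ m) (κ c) (suc n))
    (trans (y-· (y ^ₛ m · κ c) (suc n)) (y^-κ m c n))

  -- (κ a yʲ)ᵏ has order j k ≥ k.
  κy^-low : ∀ a j k f n → n ℕ.< k → ((κ a · y ^ₛ suc j) ^ₛ k · f) n ≈ 0#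
  κy^-low a j k f n n<k = trans (·-congʳ f (S.trans (CommutativeExp.^-distrib-* S.commutativeSemiring (κ a) (y ^ₛ suc j) k)
      (·-congˡ (κ a ^ₛ k) (S.trans (^ₛ-assocʳ y (suc j) k) (^ₛ-homo-* y k (j ℕ.* k))))) n)
    (trans (SS.solve 4 (λ a b c d → a SS.:* (b SS.:* c) SS.:* d SS.:= b SS.:* (a SS.:* c SS.:* d)) (λ _ → refl) (κ a ^ₛ k) (y ^ₛ k) (y ^ₛ (j ℕ.* k)) f n)
      (y^-low k (κ a ^ₛ k · y ^ₛ (j ℕ.* k) · f) n n<k))

  -- By induction on the number of coefficients, with the binomial theorem for
  -- the sum of the first one and the others. In degree N only the exponents
  -- up to N matter, which is why exponents below K suffice.
  base^ : ∀ {m} (as : Vec Carrier m) j n K N → N ℕ.< K →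
          (base (suc j) as ^ₛ n) N ≈ ∑∈ₛ (tuples (upTo K) m) (termₛ n (suc j) as) N
  base^ []       j n K N N<K = sym (trans (+-identityʳ _) (trans (+-identityʳ _) (S.*-identityʳ (κ a₀ ^ₛ n) N)))
  base^ {suc m} (a ∷ as) j n K N N<K = begin
    ((z S.+ q) ^ₛ n) N
      ≈⟨ SB.binomial-≤ z q n K N ⟩
    ∑<ₛ (suc n ℕ.+ K) b N
      ≈⟨ ∑<ₛ-coeff (suc n ℕ.+ K) b N ⟩
    ∑< (suc n ℕ.+ K) (λ k → b k N)
      ≡⟨ ≡.cong (λ B → ∑< B (λ k → b k N)) (ℕ.+-comm (suc n) K) ⟩
    ∑< (K ℕ.+ suc n) (λ k → b k N)
      ≈⟨ BinomialSum.∑<-truncate R K (suc n) _ (λ k K≤k → trans (×ₛ-coeff (n C k) (z ^ₛ k · q ^ₛ (n ∸ k)) N)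
           (trans (×ᵣ-congʳ (n C k) (κy^-low a j k (q ^ₛ (n ∸ k)) N (ℕ.<-≤-trans N<K K≤k))) (×ᵣ-zeroʳ (n C k)))) ⟩
    ∑< K (λ k → b k N)
      ≈⟨ ∑<-cong K step ⟩
    ∑< K (λ k → ∑∈ (tuples (upTo K) m) (λ i → termₛ n (suc j) (a ∷ as) (k ∷ i) N))
      ≈⟨ ∑∈-upTo K _ ⟨
    ∑∈ (upTo K) (λ k → ∑∈ (tuples (upTo K) m) (λ i → termₛ n (suc j) (a ∷ as) (k ∷ i) N))
      ≈⟨ ∑∈-cartesianProductWith _∷_ (upTo K) (tuples (upTo K) m) _ ⟨
    ∑∈ (tuples (upTo K) (suc m)) (λ i → termₛ n (suc j) (a ∷ as) i N)
      ≈⟨ ∑∈ₛ-coeff (tuples (upTo K) (suc m)) _ N ⟨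
    ∑∈ₛ (tuples (upTo K) (suc m)) (termₛ n (suc j) (a ∷ as)) N ∎
    where
    open SetoidReasoning setoid
    open Mult semiring using () renaming (×-congʳ to ×ᵣ-congʳ)
    ×ᵣ-zeroʳ : ∀ n → n ×ᵣ 0# ≈ 0#
    ×ᵣ-zeroʳ zero    = refl
    ×ᵣ-zeroʳ (suc n) = trans (+-identityˡ _) (×ᵣ-zeroʳ n)
    z q : ℕ → Carrier
    z = κ a · y ^ₛ suc j
    q = base (suc (suc j)) as
    b : ℕ → ℕ → Carrier
    b k = (n C k) ×ₛ (z ^ₛ k · q ^ₛ (n ∸ k))
    collect : ∀ k i → (n C k) ×ₛ (z ^ₛ k · termₛ (n ∸ k) (suc (suc j)) as i) ≋ termₛ n (suc j) (a ∷ as) (k ∷ i)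
    collect k i =
      S.trans (SM.×-congʳ (n C k) (SM.×-comm-* M (z ^ₛ k) _))
      (S.trans (SM.×-assocˡ _ (n C k) M)
      (SM.×-congʳ ((n C k) ℕ.* M) (S.trans (SS.solve 3 (λ a b c → a SS.:* (b SS.:* c) SS.:= b SS.:* (a SS.:* c)) (λ _ → refl)
           (z ^ₛ k) (κ a₀ ^ₛ (n ∸ k ∸ sum (toList i))) (monomialₛ (suc (suc j)) as i))
         (S.reflexive (≡.cong (λ e → κ a₀ ^ₛ e · (z ^ₛ k · monomialₛ (suc (suc j)) as i)) (ℕ.∸-+-assoc n k (sum (toList i))))))))
      where
      M : ℕ
      M = multi (n ∸ k) (toList i)
    step : ∀ k → b k N ≈
                 ∑∈ (tuples (upTo K) m) (λ i → termₛ n (suc j) (a ∷ as) (k ∷ i) N)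
    step k = begin
      b k N
        ≈⟨ ×ₛ-coeff (n C k) (z ^ₛ k · q ^ₛ (n ∸ k)) N ⟩
      (n C k) ×ᵣ (z ^ₛ k · q ^ₛ (n ∸ k)) N
        ≈⟨ ×ᵣ-congʳ (n C k) (·-cong-≤ {f = z ^ₛ k} {g = q ^ₛ (n ∸ k)} N (λ _ _ → refl) (λ l l≤N → base^ as (suc j) (n ∸ k) K l (ℕ.≤-<-trans l≤N N<K))) ⟩
      (n C k) ×ᵣ (z ^ₛ k · ∑∈ₛ (tuples (upTo K) m) (termₛ (n ∸ k) (suc (suc j)) as)) N
        ≈⟨ ×ₛ-coeff (n C k) (z ^ₛ k · ∑∈ₛ (tuples (upTo K) m) (termₛ (n ∸ k) (suc (suc j)) as)) N ⟨
      ((n C k) ×ₛ (z ^ₛ k · ∑∈ₛ (tuples (upTo K) m) (termₛ (n ∸ k) (suc (suc j)) as))) N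
        ≈⟨ trans (×ₛ-∑∈ₛ (n C k) (z ^ₛ k) (tuples (upTo K) m) (termₛ (n ∸ k) (suc (suc j)) as) N) (∑∈ₛ-cong (tuples (upTo K) m) (collect k) N) ⟩
      ∑∈ₛ (tuples (upTo K) m) (λ i → termₛ n (suc j) (a ∷ as) (k ∷ i)) N
        ≈⟨ ∑∈ₛ-coeff (tuples (upTo K) m) _ N ⟩
      ∑∈ (tuples (upTo K) m) (λ i → termₛ n (suc j) (a ∷ as) (k ∷ i) N) ∎
      where
      ×ₛ-∑∈ₛ : ∀ {A : Set} n (f : ℕ → Carrier) (xs : List A) g → n ×ₛ (f · ∑∈ₛ xs g) ≋ ∑∈ₛ xs (λ x → n ×ₛ (f · g x))
      ×ₛ-∑∈ₛ n f xs g = S.trans (S.sym {(n ×ₛ f) · ∑∈ₛ xs g} {n ×ₛ (f · ∑∈ₛ xs g)} (SM.×-assoc-* n f (∑∈ₛ xs g))) (S.trans (*-∑∈ₛ (n ×ₛ f) xs g)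
        (∑∈ₛ-cong xs (λ x → SM.×-assoc-* n f (g x))))

  base-poly : ∀ {m} j (as : Vec Carrier m) → base j as ≋ κ a₀ S.+ y ^ₛ j · poly as
  base-poly j []       = S.sym {κ a₀ S.+ y ^ₛ j · S.0#} {κ a₀}
    (S.trans (S.+-congˡ {κ a₀} (S.zeroʳ (y ^ₛ j))) (S.+-identityʳ (κ a₀)))
  base-poly j (a ∷ as) n = trans (+-congˡ (base-poly (suc j) as n))
    (SS.solve 5 (λ a b x z p → a SS.:* x SS.:+ (b SS.:+ z SS.:* x SS.:* p) SS.:= b SS.:+ x SS.:* (a SS.:+ z SS.:* p))
      (λ _ → refl) (κ a) (κ a₀) (y ^ₛ j) y (poly as) n)

  κ-^ : ∀ a n → κ a ^ₛ n ≋ κ (a ^ᵣ n)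
  κ-^ a zero    = λ _ → refl
  κ-^ a (suc n) = S.trans (·-congˡ (κ a) (κ-^ a n)) (S.sym {κ (a * a ^ᵣ n)} {κ a · κ (a ^ᵣ n)} (κ-* a (a ^ᵣ n)))

  monomialₛ-κ : ∀ {m} j (as : Vec Carrier m) i → monomialₛ j as i ≋ y ^ₛ wt j i · κ (monomial as i)
  monomialₛ-κ j []       []      = S.sym {κ 1# · κ 1#} {κ 1#} (S.*-identityˡ (κ 1#))
  monomialₛ-κ j (a ∷ as) (k ∷ i) = begin
    (κ a · y ^ₛ j) ^ₛ k · monomialₛ (suc j) as i
      ≈⟨ ·-cong {(κ a · y ^ₛ j) ^ₛ k} {κ (a ^ᵣ k) · y ^ₛ (j ℕ.* k)} power (monomialₛ-κ (suc j) as i) ⟩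
    (κ (a ^ᵣ k) · y ^ₛ (j ℕ.* k)) · (y ^ₛ wt (suc j) i · κ (monomial as i))
      ≈⟨ SS.solve 4 (λ a b c d → (a SS.:* b) SS.:* (c SS.:* d) SS.:= (b SS.:* c) SS.:* (a SS.:* d)) (λ _ → refl)
           (κ (a ^ᵣ k)) (y ^ₛ (j ℕ.* k)) (y ^ₛ wt (suc j) i) (κ (monomial as i)) ⟩
    (y ^ₛ (j ℕ.* k) · y ^ₛ wt (suc j) i) · (κ (a ^ᵣ k) · κ (monomial as i))
      ≈⟨ ·-cong (^ₛ-homo-* y (j ℕ.* k) (wt (suc j) i)) (κ-* (a ^ᵣ k) (monomial as i)) ⟨
    y ^ₛ (j ℕ.* k ℕ.+ wt (suc j) i) · κ (a ^ᵣ k * monomial as i) ∎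
    where
    open SetoidReasoning S.setoid
    power : (κ a · y ^ₛ j) ^ₛ k ≋ κ (a ^ᵣ k) · y ^ₛ (j ℕ.* k)
    power = S.trans (CommutativeExp.^-distrib-* S.commutativeSemiring (κ a) (y ^ₛ j) k)
      (·-cong {κ a ^ₛ k} (κ-^ a k) (^ₛ-assocʳ y j k))

  -- The coefficient of the term with exponents i, in degree wt j i.
  coefficient : ∀ {m} → ℕ → Vec Carrier m → Vec ℕ m → Carrier
  coefficient n as i = multi n (toList i) ×ᵣ (a₀ ^ᵣ (n ∸ sum (toList i)) * monomial as i)

  termₛ-coeff : ∀ {m} n j (as : Vec Carrier m) i N →
                termₛ n j as i N ≈ (if does (wt j i ℕ.≟ N) then coefficient n as i else 0#)
  termₛ-coeff n j as i N = begin
    termₛ n j as i N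
      ≈⟨ SM.×-congʳ M (S.trans (·-cong {κ a₀ ^ₛ (n ∸ sum (toList i))} (κ-^ a₀ (n ∸ sum (toList i))) (monomialₛ-κ j as i))
           (SS.solve 3 (λ a b c → a SS.:* (b SS.:* c) SS.:= b SS.:* (a SS.:* c)) (λ _ → refl) (κ p) (y ^ₛ wt j i) (κ (monomial as i)))) N ⟩
    (M ×ₛ (y ^ₛ wt j i · (κ p · κ (monomial as i)))) N
      ≈⟨ SM.×-comm-* M (y ^ₛ wt j i) (κ p · κ (monomial as i)) N ⟨
    (y ^ₛ wt j i · (M ×ₛ (κ p · κ (monomial as i)))) N
      ≈⟨ ·-congˡ (y ^ₛ wt j i) (S.trans (SM.×-congʳ M (S.sym {κ (p * monomial as i)} {κ p · κ (monomial as i)} (κ-* p (monomial as i)))) (×ₛ-κ M (p * monomial as i))) N ⟩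
    (y ^ₛ wt j i · κ (coefficient n as i)) N
      ≈⟨ y^-κ (wt j i) (coefficient n as i) N ⟩
    (if does (wt j i ℕ.≟ N) then coefficient n as i else 0#) ∎
    where
    open SetoidReasoning setoid
    M : ℕ
    M = multi n (toList i)
    p : Carrier
    p = a₀ ^ᵣ (n ∸ sum (toList i))
    ×ₛ-κ : ∀ m c → m ×ₛ κ c ≋ κ (m ×ᵣ c)
    ×ₛ-κ zero    c = λ { zero → refl ; (suc _) → refl }
    ×ₛ-κ (suc m) c n = trans (+-congˡ (×ₛ-κ m c n)) (sym (κ-+ c (m ×ᵣ c) n))

  multinomialTheorem : ∀ {m} (as : Vec Carrier m) j n {N K} → N ℕ.< K →
    ((κ a₀ S.+ y ^ₛ suc j · poly as) ^ₛ n) N ≈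
    ∑∈ (filter (λ i → wt (suc j) i ℕ.≟ N) (tuples (upTo K) m)) (coefficient n as)
  multinomialTheorem {m} as j n {N} {K} N<K = begin
    ((κ a₀ S.+ y ^ₛ suc j · poly as) ^ₛ n) N                 ≈⟨ Exp.^-congˡ S.semiring n (base-poly (suc j) as) N ⟨
    (base (suc j) as ^ₛ n) N                                 ≈⟨ base^ as j n K N N<K ⟩
    ∑∈ₛ (tuples (upTo K) m) (termₛ n (suc j) as) N           ≈⟨ ∑∈ₛ-coeff (tuples (upTo K) m) (termₛ n (suc j) as) N ⟩
    ∑∈ (tuples (upTo K) m) (λ i → termₛ n (suc j) as i N)    ≈⟨ ∑∈-cong (tuples (upTo K) m) (λ i → termₛ-coeff n (suc j) as i N) ⟩
    ∑∈ (tuples (upTo K) m) (λ i → if does (wt (suc j) i ℕ.≟ N) then coefficient n as i else 0#)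
      ≈⟨ ∑∈-filter (λ i → wt (suc j) i ℕ.≟ N) (tuples (upTo K) m) (coefficient n as) ⟨
    ∑∈ (filter (λ i → wt (suc j) i ℕ.≟ N) (tuples (upTo K) m)) (coefficient n as) ∎
    where open SetoidReasoning setoid

multi-factorials : ∀ n ks → sum ks ≤ n → multi n ks ℕ.* product (map _! (n ∸ sum ks ∷ ks)) ≡.≡ n !
multi-factorials n []       _  = ≡.trans (ℕ.*-identityˡ _) (ℕ.*-identityʳ _)
multi-factorials n (k ∷ ks) le = begin
  (n C k) ℕ.* M ℕ.* ((n ∸ (k ℕ.+ s)) ! ℕ.* (k ! ℕ.* p))
    ≡⟨ ≡.cong (λ e → (n C k) ℕ.* M ℕ.* (e ! ℕ.* (k ! ℕ.* p))) (≡.sym (ℕ.∸-+-assoc n k s)) ⟩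
  (n C k) ℕ.* M ℕ.* ((n ∸ k ∸ s) ! ℕ.* (k ! ℕ.* p))
    ≡⟨ solve 5 (λ a b c d e → a :* b :* (c :* (d :* e)) := a :* (d :* (b :* (c :* e)))) ≡.refl (n C k) M ((n ∸ k ∸ s) !) (k !) p ⟩
  (n C k) ℕ.* (k ! ℕ.* (M ℕ.* ((n ∸ k ∸ s) ! ℕ.* p)))
    ≡⟨ ≡.cong (λ e → (n C k) ℕ.* (k ! ℕ.* e)) (multi-factorials (n ∸ k) ks (ℕ.≤-trans (ℕ.≤-reflexive (≡.sym (ℕ.m+n∸m≡n k s))) (ℕ.∸-monoˡ-≤ k le))) ⟩
  (n C k) ℕ.* (k ! ℕ.* (n ∸ k) !)
    ≡⟨ ≡.cong (ℕ._* (k ! ℕ.* (n ∸ k) !)) (nCk≡n!/k![n-k]! k≤n) ⟩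
  ((n !) ℕ./ (k ! ℕ.* (n ∸ k) !)) ℕ.* (k ! ℕ.* (n ∸ k) !)
    ≡⟨ m/n*n≡m (k![n∸k]!∣n! k≤n) ⟩
  n ! ∎
  where
  open ≡.≡-Reasoning
  open Solver ℕ.+-*-commutativeSemiring using (solve; _:=_; _:*_)
  s M p : ℕ
  s = sum ks
  M = multi (n ∸ k) ks
  p = product (map _! ks)
  k≤n : k ≤ n
  k≤n = ℕ.≤-trans (ℕ.m≤m+n k s) le
  instance
    nz : ℕ.NonZero (k ! ℕ.* (n ∸ k) !)
    nz = ℕ._!*_!≢0 k (n ∸ k)

-- Reading Dyck paths from right to left

module RightToLeft where
  open import Data.Nat.Base using (_+_; _*_)
  open ≡ using (_≡_; refl; sym; trans; cong; cong₂; subst; subst₂)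

  -- What a reader of a path from right to left knows at a point: the step that
  -- follows the point (D if there is none), the height of the point, and a
  -- strict upper bound for the level of the next valley to be met, if a valley
  -- has been met already.
  record State : Set where
    constructor state
    field
      next   : Step
      height : ℕ
      bound  : Maybe ℕ

  initial : State
  initial = state D 0 nothing

  -- Whether a valley of level h is permitted by the bound.
  below : ℕ → Maybe ℕ → Bool
  below h nothing  = true
  below h (just b) = h ℕ.<ᵇ b

  -- Reading one more step. A step D read after U completes a valley, whose
  -- level is the current height h; the valley before it then has level at most
  -- h + e. There is no new state when the axis or the bound is violated.
  extend : ℕ → Step → State → Maybe State
  extend e U (state s zero b) = nothing
  extend e U (state s (suc h) b) = just (state U h b)
  extend e D (state D h b) = just (state D (suc h) b)
  extend e D (state U h b) = if below h b then just (state D (suc h) (just (suc (h + e)))) else nothing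

  -- The state after a whole word is read from right to left.
  run : ℕ → Maybe State → List Step → Maybe State
  run e σ []      = σ
  run e σ (s ∷ w) = run e σ w >>= extend e s

  accepting : Maybe State → Bool
  accepting (just (state _ zero _))  = true
  accepting (just (state _ (suc _) _)) = false
  accepting nothing                  = false

  firstStep : List Step → Step
  firstStep []      = D
  firstStep (s ∷ _) = s

  -- The bound that belongs to the valley levels of the part already read.
  data Bounds (e : ℕ) : Maybe ℕ → List ℤ → Set where
    none  : Bounds e nothing []
    first : ∀ {ν νs} → Bounds e (just (suc (ν + e))) (ℤ.+ ν ∷ νs)

  -- The condition on consecutive valley levels for d = - (m + 1).
  Gap : ℕ → ℤ → ℤ → Set
  Gap m ν ν′ = -[1+ m ] ℤ.≤ ν′ ℤ.- ν

  module _ (m : ℕ) where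
    private
      e : ℕ
      e = suc m

      ⊖-cancel : ∀ k → k ℤ.⊖ (k + suc m) ≡ -[1+ m ]
      ⊖-cancel k = trans (cong (ℤ._⊖ (k + suc m)) (sym (ℕ.+-identityʳ k))) (ℤ.+-cancelˡ-⊖ k 0 (suc m))

    gap⇒< : ∀ h k → Gap m (ℤ.+ h) (ℤ.+ k) → h ℕ.< suc (k + e)
    gap⇒< h k gap with h ℕ.<? suc (k + e)
    ... | yes p = p
    ... | no ¬p = contradiction gap (ℤ.<⇒≱ (subst₂ ℤ._<_ (sym (ℤ.m-n≡m⊖n k h)) (⊖-cancel k)
                    (ℤ.⊖-monoʳ->-< k (ℕ.≮⇒≥ ¬p))))

    <⇒gap : ∀ h k → h ℕ.< suc (k + e) → Gap m (ℤ.+ h) (ℤ.+ k)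
    <⇒gap h k (s≤s p) = subst₂ ℤ._≤_ (⊖-cancel k) (sym (ℤ.m-n≡m⊖n k h)) (ℤ.⊖-monoʳ-≥-≤ k p)

    below⇒linked : ∀ {h b νs} → Bounds e b νs → T (below h b) → Linked (Gap m) νs → Linked (Gap m) (ℤ.+ h ∷ νs)
    below⇒linked     none      _ _  = [-]
    below⇒linked {h} (first {ν}) p νs = <⇒gap h ν (ℕ.<ᵇ⇒< h _ p) ∷ νs

    linked⇒below : ∀ {h b νs} → Bounds e b νs → Linked (Gap m) (ℤ.+ h ∷ νs) → T (below h b)
    linked⇒below     none      _       = tt
    linked⇒below {h} (first {ν}) (gap ∷ _) = ℕ.<⇒<ᵇ (gap⇒< h ν gap)

    -- The word w is the right part of a d-Dyck path, read with final state σ.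
    record Describes (σ : State) (w : List Step) : Set where
      open State σ
      field
        dyck   : Dyck height w
        linked : Linked (Gap m) (valleyLevels (ℤ.+ height) w)
        next≡  : firstStep w ≡ next
        bounds : Bounds e bound (valleyLevels (ℤ.+ height) w)

    sound : ∀ w {σ} → run e (just initial) w ≡ just σ → Describes σ w
    sound [] refl = record { dyck = done ; linked = [] ; next≡ = refl ; bounds = none }
    sound (s ∷ w) eq with run e (just initial) w in eqw
    sound (U ∷ w) refl | just (state s (suc h) b) = record { dyck = up dyck ; linked = linked ; next≡ = refl ; bounds = bounds }
      where open Describes (sound w eqw)
    sound (D ∷ w) refl | just (state D h b) with w | sound w eqw
    ... | []    | record { dyck = dyck ; bounds = none } = record { dyck = down dyck ; linked = [] ; next≡ = refl ; bounds = none }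
    ... | D ∷ _ | p = record { dyck = down dyck ; linked = linked ; next≡ = refl ; bounds = bounds }
      where open Describes p
    sound (D ∷ w) eq | just (state U h b) with below h b in eqb
    sound (D ∷ w) refl | just (state U h b) | true with w | sound w eqw
    ... | U ∷ _ | p = record { dyck = down dyck ; linked = below⇒linked bounds (subst T (sym eqb) tt) linked ; next≡ = refl ; bounds = first }
      where open Describes p

    complete : ∀ {h} w → Dyck h w → Linked (Gap m) (valleyLevels (ℤ.+ h) w) →
               ∃[ s ] ∃[ b ] run e (just initial) w ≡ just (state s h b)
    complete [] done _ = D , nothing , refl
    complete (U ∷ w) (up p) l with complete w p l
    ... | s , b , eq rewrite eq = U , b , refl
    complete (D ∷ []) (down done) l = D , nothing , refl
    complete (D ∷ w@(D ∷ _)) (down p) l with complete w p l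
    ... | s , b , eq with sound w eq
    ... | record { next≡ = refl } rewrite eq = D , b , refl
    complete (D ∷ w@(U ∷ _)) (down {h} p) l with complete w p (Linked.tail l)
    ... | s , b , eq with sound w eq
    ... | record { next≡ = refl ; bounds = bounds } rewrite eq | Equivalence.to T-≡ (linked⇒below bounds l) = D , _ , refl

  -- The number of words of a given length with a given property.
  count : ℕ → (List Step → Bool) → ℕ
  count zero    P = if P [] then 1 else 0
  count (suc n) P = count n (P ∘ (U ∷_)) + count n (P ∘ (D ∷_))

  count-cong : ∀ n {P Q} → (∀ w → length w ≡ n → P w ≡ Q w) → count n P ≡ count n Q
  count-cong zero    p = cong (if_then 1 else 0) (p [] refl)
  count-cong (suc n) p = cong₂ _+_ (count-cong n λ w eq → p (U ∷ w) (cong suc eq))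
                                   (count-cong n λ w eq → p (D ∷ w) (cong suc eq))

  -- Words can be counted by their last letter as well as by their first.
  count-∷ʳ : ∀ n P → count (suc n) P ≡ count n (P ∘ (_∷ʳ U)) + count n (P ∘ (_∷ʳ D))
  count-∷ʳ zero    P = refl
  count-∷ʳ (suc n) P = trans
    (cong₂ _+_ (count-∷ʳ n (P ∘ (U ∷_))) (count-∷ʳ n (P ∘ (D ∷_))))
    (interchange (count n (λ w → P (U ∷ w ∷ʳ U))) (count n (λ w → P (U ∷ w ∷ʳ D)))
       (count n (λ w → P (D ∷ w ∷ʳ U))) (count n (λ w → P (D ∷ w ∷ʳ D))))
    where open CommutativeSemigroup ℕ.+-commutativeSemigroup using (interchange)

  count-filter : ∀ n {P : Pred (List Step) 0ℓ} (P? : Decidable P) →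
                 length (filter P? (map toList (tuples (U ∷ D ∷ []) n))) ≡ count n (does ∘ P?)
  count-filter zero    P? with does (P? [])
  ... | true  = refl
  ... | false = refl
  count-filter (suc n) P? = begin
    length (filter P? (map toList (cartesianProductWith _∷_ (U ∷ D ∷ []) ts)))
      ≡⟨ cong (length ∘ filter P?) (words ts (U ∷ D ∷ [])) ⟩
    length (filter P? (map (U ∷_) ws ++ map (D ∷_) ws ++ []))
      ≡⟨ cong length (filter-++ P? (map (U ∷_) ws) (map (D ∷_) ws ++ [])) ⟩
    length (filter P? (map (U ∷_) ws) ++ filter P? (map (D ∷_) ws ++ []))
      ≡⟨ length-++ (filter P? (map (U ∷_) ws)) ⟩
    length (filter P? (map (U ∷_) ws)) + length (filter P? (map (D ∷_) ws ++ []))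
      ≡⟨ cong₂ _+_ (filter-map (U ∷_) ws) (trans (cong (length ∘ filter P?) (++-identityʳ (map (D ∷_) ws))) (filter-map (D ∷_) ws)) ⟩
    length (filter (P? ∘ (U ∷_)) ws) + length (filter (P? ∘ (D ∷_)) ws)
      ≡⟨ cong₂ _+_ (count-filter n (P? ∘ (U ∷_))) (count-filter n (P? ∘ (D ∷_))) ⟩
    count n (does ∘ P? ∘ (U ∷_)) + count n (does ∘ P? ∘ (D ∷_)) ∎
    where
    open ≡.≡-Reasoning
    ts : List (Vec Step n)
    ts = tuples (U ∷ D ∷ []) n
    ws : List (List Step)
    ws = map toList ts
    words : ∀ (vs : List (Vec Step n)) ss → map toList (cartesianProductWith _∷_ ss vs) ≡
            cartesianProductWith _∷_ ss (map toList vs)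
    words vs []       = refl
    words vs (s ∷ ss) = trans (map-++ toList (map (s ∷_) vs) _)
      (cong₂ _++_ (trans (sym (map-∘ vs)) (map-∘ vs)) (words vs ss))
    filter-map : ∀ (f : List Step → List Step) xs → length (filter P? (map f xs)) ≡ length (filter (P? ∘ f) xs)
    filter-map f []       = refl
    filter-map f (x ∷ xs) with does (P? (f x))
    ... | true  = cong suc (filter-map f xs)
    ... | false = filter-map f xs

  -- The number of words of length n that lead from σ to an accepting state.
  extensions : ℕ → ℕ → Maybe State → ℕ
  extensions e n σ = count n (accepting ∘ run e σ)

  run-∷ʳ : ∀ e σ s w → run e σ (w ∷ʳ s) ≡ run e (σ >>= extend e s) w
  run-∷ʳ e σ s []      = refl
  run-∷ʳ e σ s (t ∷ w) = cong (_>>= extend e t) (run-∷ʳ e σ s w)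

  extensions-step : ∀ e n σ → extensions e (suc n) σ ≡
                    extensions e n (σ >>= extend e U) + extensions e n (σ >>= extend e D)
  extensions-step e n σ = trans (count-∷ʳ n (accepting ∘ run e σ))
    (cong₂ _+_ (count-cong n λ w _ → cong accepting (run-∷ʳ e σ U w))
               (count-cong n λ w _ → cong accepting (run-∷ʳ e σ D w)))

  extensions-nothing : ∀ e n → extensions e n nothing ≡ 0
  extensions-nothing e zero    = refl
  extensions-nothing e (suc n) = trans (extensions-step e n nothing)
    (cong₂ _+_ (extensions-nothing e n) (extensions-nothing e n))

  -- From height h, at least h steps are needed to reach the x-axis.
  extensions-short : ∀ e n s h b → n ℕ.< h → extensions e n (just (state s h b)) ≡ 0
  extensions-short e zero    s (suc h) b _ = refl
  extensions-short e (suc n) s (suc h) b (s≤s n<h) = trans (extensions-step e n (just (state s (suc h) b)))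
    (cong₂ _+_ (extensions-short e n U h b n<h) (descend s))
    where
    n<2+h : n ℕ.< suc (suc h)
    n<2+h = ℕ.m≤n⇒m≤1+n (ℕ.m≤n⇒m≤1+n n<h)
    descend : ∀ s → extensions e n (extend e D (state s (suc h) b)) ≡ 0
    descend D = extensions-short e n D (suc (suc h)) b n<2+h
    descend U with below (suc h) b
    ... | true  = extensions-short e n D (suc (suc h)) _ n<2+h
    ... | false = extensions-nothing e n

  r≡extensions : ∀ m n → r -[1+ m ] n ≡ extensions (suc m) (2 * n) (just initial)
  r≡extensions m n = trans (count-filter (2 * n) (isDDyck? -[1+ m ] n))
    (count-cong (2 * n) λ w eq → does-⇔ (mk⇔ (to w) (from w eq)) (isDDyck? -[1+ m ] n w) (T? (acc w)))
    where
    acc : List Step → Bool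
    acc w = accepting (run (suc m) (just initial) w)
    length≡ : ∀ {h w} → Dyck h w → h + 2 * semilength w ≡ length w
    length≡ done = refl
    length≡ {h} (up {p = p} d) = trans (cong (h +_) (ℕ.*-suc 2 (semilength p)))
      (trans (ℕ.+-suc h _) (cong suc (trans (ℕ.+-suc h _) (length≡ d))))
    length≡ (down d) = cong suc (length≡ d)
    to : ∀ w → IsDDyck -[1+ m ] n w → T (acc w)
    to w (d , _ , l) with complete m w d l
    ... | _ , _ , eq rewrite eq = tt
    from : ∀ w → length w ≡ 2 * n → T (acc w) → IsDDyck -[1+ m ] n w
    from w eq p with run (suc m) (just initial) w in eqw
    ... | just (state _ zero _) = dyck , ℕ.*-cancelˡ-≡ _ _ 2 (trans (length≡ dyck) eq) , linked
      where open Describes (sound m w eqw)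

open RightToLeft

-- The generating functions and their functional equation

-- Here x is the variable of the generating functions. It marks the D steps: a
-- Dyck path has as many of them as U steps, and reading a D step from right to
-- left is what increases the height.
module GeneratingFunctions
  (R : CommutativeRing 0ℓ 0ℓ) (e : ℕ) (x : CommutativeRing.Carrier R)
  where
  open CommutativeRing R hiding (zero)
  open SetoidReasoning setoid
  open Solver commutativeSemiring using (solve; _:=_; _:+_; _:*_; con)
  open Exp semiring using () renaming (_^_ to _^ᵣ_)

  -- E counts the sequences of components that can be followed by a U step, A
  -- all d-Dyck paths, and Z k the d-Dyck paths whose last valley, if any, has
  -- level less than k; the empty path is included in each case.
  record System : Set where
    field
      E A : Carrier
      Z   : ℕ → Carrier
      Z-zero : Z 0 ≈ 1# + x * Z 0
      Z-suc  : ∀ k → Z (suc k) ≈ 1# + x * E * Z k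
      E-eq   : E ≈ 1# + x * E * Z e
      A-eq   : A ≈ 1# + x * E * A

  module _ (system : System) where
    open System system

    -- The paths from the origin to height h that end with U (or are empty, if
    -- h = 0) and have no valley of level b or more in last place. Cutting at
    -- the last visit of each height i < h leaves h independent factors E, of
    -- which those at height b or more have to be trivial.
    climb : ℕ → Maybe ℕ → Carrier
    climb h nothing  = E ^ᵣ h
    climb h (just b) = E ^ᵣ (h ℕ.⊓ b)

    -- The words that lead from a state to an accepting one: left parts of
    -- paths, cut at the last visits of the heights below h.
    gf : State → Carrier
    gf (state U h b)        = climb (suc h) b
    gf (state D h nothing)  = E ^ᵣ h * A
    gf (state D h (just b)) = E ^ᵣ (h ℕ.⊓ b) * Z (b ∸ h)

    gf? : Maybe State → Carrier
    gf? (just σ) = gf σ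
    gf? nothing  = 0#

    private
      step : ∀ c p z → c * (1# + x * p * z) ≈ c + x * ((p * c) * z)
      step = solve 4 (λ x c p z → c :* (con 1 :+ x :* p :* z) := c :+ x :* ((p :* c) :* z)) refl x

      valley : ∀ h → E ^ᵣ suc h ≈ E ^ᵣ h + x * gf (state D (suc h) (just (suc (h ℕ.+ e))))
      valley h rewrite ℕ.m≤n⇒m⊓n≡m (ℕ.m≤m+n h e) | ℕ.m+n∸m≡n h e =
        trans (*-comm E (E ^ᵣ h)) (trans (*-congˡ E-eq) (step (E ^ᵣ h) E (Z e)))

    -- The recursion that determines the numbers of accepted words, by the last
    -- step of the left part: U or nothing (climb), or D.
    gf-eq : ∀ s h b → gf (state s h b) ≈ climb h b + x * gf? (extend e D (state s h b))
    gf-eq D h nothing = trans (*-congˡ A-eq) (step (E ^ᵣ h) E A)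
    gf-eq D h (just b) with h ℕ.<? b
    ... | yes h<b rewrite ℕ.m≤n⇒m⊓n≡m h<b | ℕ.m≤n⇒m⊓n≡m (ℕ.<⇒≤ h<b) = begin
      E ^ᵣ h * Z (b ∸ h)                              ≡⟨ ≡.cong (λ k → E ^ᵣ h * Z k) (ℕ.+-∸-assoc 1 h<b) ⟩
      E ^ᵣ h * Z (suc (b ∸ suc h))                    ≈⟨ *-congˡ (Z-suc (b ∸ suc h)) ⟩
      E ^ᵣ h * (1# + x * E * Z (b ∸ suc h))           ≈⟨ step (E ^ᵣ h) E _ ⟩
      E ^ᵣ h + x * (E ^ᵣ suc h * Z (b ∸ suc h))        ∎
    ... | no h≮b rewrite ℕ.m≥n⇒m⊓n≡n (ℕ.≮⇒≥ h≮b) | ℕ.m≥n⇒m⊓n≡n (ℕ.m≤n⇒m≤1+n (ℕ.≮⇒≥ h≮b))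
                       | ℕ.m≤n⇒m∸n≡0 (ℕ.≮⇒≥ h≮b) | ℕ.m≤n⇒m∸n≡0 (ℕ.m≤n⇒m≤1+n (ℕ.≮⇒≥ h≮b)) = begin
      E ^ᵣ b * Z 0                  ≈⟨ *-congˡ Z-zero ⟩
      E ^ᵣ b * (1# + x * Z 0)       ≈⟨ solve 3 (λ x c z → c :* (con 1 :+ x :* z) := c :+ x :* (c :* z)) refl x _ _ ⟩
      E ^ᵣ b + x * (E ^ᵣ b * Z 0)    ∎
    gf-eq U h nothing = valley h
    gf-eq U h (just b) with h ℕ.<ᵇ b in eq
    ... | true  = allowed (ℕ.<ᵇ⇒< h b (≡.subst T (≡.sym eq) tt))
      where
      allowed : h ℕ.< b → E ^ᵣ (suc h ℕ.⊓ b) ≈ E ^ᵣ (h ℕ.⊓ b) + x * gf (state D (suc h) (just (suc (h ℕ.+ e))))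
      allowed h<b rewrite ℕ.m≤n⇒m⊓n≡m h<b | ℕ.m≤n⇒m⊓n≡m (ℕ.<⇒≤ h<b) = valley h
    ... | false = forbidden (ℕ.≮⇒≥ (λ h<b → ≡.subst T eq (ℕ.<⇒<ᵇ h<b)))
      where
      forbidden : b ≤ h → E ^ᵣ (suc h ℕ.⊓ b) ≈ E ^ᵣ (h ℕ.⊓ b) + x * 0#
      forbidden b≤h rewrite ℕ.m≥n⇒m⊓n≡n b≤h | ℕ.m≥n⇒m⊓n≡n (ℕ.m≤n⇒m≤1+n b≤h) =
        sym (trans (+-congˡ (zeroʳ x)) (+-identityʳ _))

    -- The nonempty d-Dyck paths.
    ℓ : Carrier
    ℓ = x * E * A

    -- Z k is a geometric sum with ratio ℓ / A, up to its last term.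
    Z-sum : ∀ k → A ^ᵣ k * Z k + A * ℓ ^ᵣ k ≈ A ^ᵣ suc k + ℓ ^ᵣ k * Z 0
    Z-sum zero    = solve 2 (λ a z → con 1 :* z :+ a :* con 1 := a :* con 1 :+ con 1 :* z) refl A (Z 0)
    Z-sum (suc k) = begin
      A ^ᵣ suc k * Z (suc k) + A * ℓ ^ᵣ suc k
        ≈⟨ +-congʳ (*-congˡ (Z-suc k)) ⟩
      A ^ᵣ suc k * (1# + x * E * Z k) + A * ℓ ^ᵣ suc k
        ≈⟨ solve 6 (λ a x c u z l → a :* u :* (con 1 :+ x :* c :* z) :+ a :* (x :* c :* a :* l)
             := a :* u :+ x :* c :* a :* (u :* z :+ a :* l)) refl A x E (A ^ᵣ k) (Z k) (ℓ ^ᵣ k) ⟩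
      A ^ᵣ suc k + ℓ * (A ^ᵣ k * Z k + A * ℓ ^ᵣ k)
        ≈⟨ +-congˡ (*-congˡ (Z-sum k)) ⟩
      A ^ᵣ suc k + ℓ * (A ^ᵣ suc k + ℓ ^ᵣ k * Z 0)
        ≈⟨ solve 4 (λ u l v z → u :+ l :* (u :+ v :* z) := (con 1 :+ l) :* u :+ l :* v :* z) refl (A ^ᵣ suc k) ℓ (ℓ ^ᵣ k) (Z 0) ⟩
      (1# + ℓ) * A ^ᵣ suc k + ℓ ^ᵣ suc k * Z 0
        ≈⟨ +-congʳ (*-congʳ A-eq) ⟨
      A ^ᵣ suc (suc k) + ℓ ^ᵣ suc k * Z 0 ∎

    -- ℓ A^e = x A^(e+2) - x ℓ^(e+2) + x² ℓ^(e+1) / (1 - x)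
    functional-equation : ℓ * A ^ᵣ e + x * ℓ ^ᵣ (2 ℕ.+ e) ≈ x * A ^ᵣ (2 ℕ.+ e) + x * x * Z 0 * ℓ ^ᵣ suc e
    functional-equation = begin
      ℓ * A ^ᵣ e + x * ℓ ^ᵣ (2 ℕ.+ e)
        ≈⟨ +-congʳ (*-congʳ (*-congʳ (*-congˡ E-eq))) ⟩
      x * (1# + x * E * Z e) * A * A ^ᵣ e + x * ℓ ^ᵣ (2 ℕ.+ e)
        ≈⟨ solve 6 (λ x c z a u v → x :* (con 1 :+ x :* c :* z) :* a :* u :+ x :* v
             := x :* (a :* u) :+ x :* (x :* c :* a) :* (u :* z) :+ x :* v) refl x E (Z e) A (A ^ᵣ e) (ℓ ^ᵣ (2 ℕ.+ e)) ⟩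
      x * A ^ᵣ suc e + x * ℓ * (A ^ᵣ e * Z e) + x * ℓ ^ᵣ (2 ℕ.+ e)
        ≈⟨ cancel ⟩
      x * A ^ᵣ suc e + x * ℓ * A ^ᵣ suc e + x * x * Z 0 * ℓ ^ᵣ suc e
        ≈⟨ solve 4 (λ x u l v → x :* u :+ x :* l :* u :+ v := x :* ((con 1 :+ l) :* u) :+ v) refl x (A ^ᵣ suc e) ℓ _ ⟩
      x * ((1# + ℓ) * A ^ᵣ suc e) + x * x * Z 0 * ℓ ^ᵣ suc e
        ≈⟨ +-congʳ (*-congˡ (*-congʳ A-eq)) ⟨
      x * A ^ᵣ (2 ℕ.+ e) + x * x * Z 0 * ℓ ^ᵣ suc e ∎
      where
      open AbelianGroupProperties +-abelianGroup using (∙-cancelʳ)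
      -- Z-sum, with A = 1 + ℓ and Z 0 = 1 + x Z 0 to make x ℓ^(e+1) appear on
      -- both sides.
      cancel : x * A ^ᵣ suc e + x * ℓ * (A ^ᵣ e * Z e) + x * ℓ ^ᵣ (2 ℕ.+ e) ≈
               x * A ^ᵣ suc e + x * ℓ * A ^ᵣ suc e + x * x * Z 0 * ℓ ^ᵣ suc e
      cancel = ∙-cancelʳ (x * ℓ ^ᵣ suc e) _ _ (begin
        x * A ^ᵣ suc e + x * ℓ * (A ^ᵣ e * Z e) + x * ℓ ^ᵣ (2 ℕ.+ e) + x * ℓ ^ᵣ suc e
          ≈⟨ solve 5 (λ x u l p q → x :* u :+ x :* l :* p :+ x :* (l :* (l :* q)) :+ x :* (l :* q)
               := x :* u :+ x :* l :* (p :+ (con 1 :+ l) :* q)) refl x (A ^ᵣ suc e) ℓ (A ^ᵣ e * Z e) (ℓ ^ᵣ e) ⟩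
        x * A ^ᵣ suc e + x * ℓ * (A ^ᵣ e * Z e + (1# + ℓ) * ℓ ^ᵣ e)
          ≈⟨ +-congˡ (*-congˡ (+-congˡ (*-congʳ A-eq))) ⟨
        x * A ^ᵣ suc e + x * ℓ * (A ^ᵣ e * Z e + A * ℓ ^ᵣ e)
          ≈⟨ +-congˡ (*-congˡ (Z-sum e)) ⟩
        x * A ^ᵣ suc e + x * ℓ * (A ^ᵣ suc e + ℓ ^ᵣ e * Z 0)
          ≈⟨ +-congˡ (*-congˡ (+-congˡ (*-congˡ Z-zero))) ⟩
        x * A ^ᵣ suc e + x * ℓ * (A ^ᵣ suc e + ℓ ^ᵣ e * (1# + x * Z 0))
          ≈⟨ solve 5 (λ x u l q z → x :* u :+ x :* l :* (u :+ q :* (con 1 :+ x :* z))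
               := x :* u :+ x :* l :* u :+ x :* x :* z :* (l :* q) :+ x :* (l :* q)) refl x (A ^ᵣ suc e) ℓ (ℓ ^ᵣ e) (Z 0) ⟩
        x * A ^ᵣ suc e + x * ℓ * A ^ᵣ suc e + x * x * Z 0 * ℓ ^ᵣ suc e + x * ℓ ^ᵣ suc e ∎)

-- The functional equation as a polynomial equation for ℓ.
module Expansion (R : CommutativeRing 0ℓ 0ℓ) where
  open CommutativeRing R hiding (zero)
  open SetoidReasoning setoid
  open Solver commutativeSemiring using (solve; _:=_; _:+_; _:*_; con)
  open Exp semiring using (^-congˡ) renaming (_^_ to _^ᵣ_)
  open Mult semiring using () renaming (_×_ to _×ᵣ_; ×-congʳ to ×ᵣ-congʳ; ×-congˡ to ×ᵣ-congˡ; ×-homo-1 to ×ᵣ-homo-1; ×-assoc-* to ×ᵣ-assoc-*)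
  open RangeSum R
  open BinomialSum R
  open Polynomial R using (eval)

  -- The coefficients a 0, …, a (m - 1), t.
  coefficients : ∀ m → (ℕ → Carrier) → Carrier → Vec Carrier (suc m)
  coefficients zero    a t = t ∷ []
  coefficients (suc m) a t = a 0 ∷ coefficients m (λ k → a (suc k)) t

  eval-coefficients : ∀ m a t ℓ → eval (coefficients m a t) ℓ ≈ ∑< m (λ k → a k * ℓ ^ᵣ k) + t * ℓ ^ᵣ m
  eval-coefficients zero    a t ℓ = solve 2 (λ t l → t :+ l :* con 0 := con 0 :+ t :* con 1) refl t ℓ
  eval-coefficients (suc m) a t ℓ = begin
    a 0 + ℓ * eval (coefficients m (λ k → a (suc k)) t) ℓ
      ≈⟨ +-congˡ (*-congˡ (eval-coefficients m (λ k → a (suc k)) t ℓ)) ⟩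
    a 0 + ℓ * (∑< m (λ k → a (suc k) * ℓ ^ᵣ k) + t * ℓ ^ᵣ m)
      ≈⟨ solve 5 (λ a l s t p → a :+ l :* (s :+ t :* p) := (a :* con 1 :+ l :* s) :+ t :* (l :* p)) refl (a 0) ℓ _ t (ℓ ^ᵣ m) ⟩
    (a 0 * 1# + ℓ * ∑< m (λ k → a (suc k) * ℓ ^ᵣ k)) + t * ℓ ^ᵣ suc m
      ≈⟨ +-congʳ (+-congˡ (trans (*-∑< m ℓ _) (∑<-cong m (λ k → solve 3 (λ l a p → l :* (a :* p) := a :* (l :* p)) refl ℓ (a (suc k)) (ℓ ^ᵣ k))))) ⟩
    ∑< (suc m) (λ k → a k * ℓ ^ᵣ k) + t * ℓ ^ᵣ suc m ∎

  private
    binomial-1+ : ∀ ℓ n → (1# + ℓ) ^ᵣ n ≈ ∑< (suc n) (λ k → (n C k) ×ᵣ 1# * ℓ ^ᵣ k)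
    binomial-1+ ℓ n = trans (^-congˡ n (+-comm 1# ℓ)) (trans (binomial ℓ 1# n)
      (∑<-cong (suc n) (λ k → trans (×ᵣ-congʳ (n C k) (trans (*-congˡ (1^ (n ∸ k))) (*-comm _ _))) (sym (×ᵣ-assoc-* (n C k) 1# (ℓ ^ᵣ k))))))
      where
      1^ : ∀ k → 1# ^ᵣ k ≈ 1#
      1^ zero    = refl
      1^ (suc k) = trans (*-identityˡ _) (1^ k)

    -- The first and the last coefficient of (1 + ℓ)ⁿ⁺¹ are 1.
    split-1+ : ∀ ℓ n → (1# + ℓ) ^ᵣ suc n ≈ 1# + ℓ * ∑< n (λ k → (suc n C suc k) ×ᵣ 1# * ℓ ^ᵣ k) + ℓ ^ᵣ suc n
    split-1+ ℓ n = begin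
      (1# + ℓ) ^ᵣ suc n
        ≈⟨ binomial-1+ ℓ (suc n) ⟩
      (1 ×ᵣ 1#) * 1# + ∑< (suc n) (λ k → (suc n C suc k) ×ᵣ 1# * (ℓ * ℓ ^ᵣ k))
        ≈⟨ +-congˡ (∑<-last n _) ⟩
      (1 ×ᵣ 1#) * 1# + (∑< n (λ k → (suc n C suc k) ×ᵣ 1# * (ℓ * ℓ ^ᵣ k)) + (suc n C suc n) ×ᵣ 1# * (ℓ * ℓ ^ᵣ n))
        ≈⟨ +-cong (trans (*-identityʳ _) (×ᵣ-homo-1 1#)) (+-cong
             (trans (∑<-cong n (λ k → solve 3 (λ c l p → c :* (l :* p) := l :* (c :* p)) refl _ ℓ (ℓ ^ᵣ k))) (sym (*-∑< n ℓ _)))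
             (trans (*-congʳ (trans (×ᵣ-congˡ (nCn≡1 (suc n))) (×ᵣ-homo-1 1#))) (*-identityˡ _))) ⟩
      1# + (ℓ * ∑< n (λ k → (suc n C suc k) ×ᵣ 1# * ℓ ^ᵣ k) + ℓ ^ᵣ suc n)
        ≈⟨ +-assoc _ _ _ ⟨
      1# + ℓ * ∑< n (λ k → (suc n C suc k) ×ᵣ 1# * ℓ ^ᵣ k) + ℓ ^ᵣ suc n ∎

    -- Both coefficients next to those are n + 3.
    split-2+ : ∀ ℓ n → let c = (3 ℕ.+ n) ×ᵣ 1# in (1# + ℓ) ^ᵣ (3 ℕ.+ n) ≈
      1# + c * ℓ + ℓ * (ℓ * ∑< n (λ k → ((3 ℕ.+ n) C (2 ℕ.+ k)) ×ᵣ 1# * ℓ ^ᵣ k)) + c * ℓ ^ᵣ (2 ℕ.+ n) + ℓ ^ᵣ (3 ℕ.+ n)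
    split-2+ ℓ n = begin
      (1# + ℓ) ^ᵣ N
        ≈⟨ split-1+ ℓ (2 ℕ.+ n) ⟩
      1# + ℓ * ((N C 1) ×ᵣ 1# * 1# + ∑< (suc n) (λ k → (N C (2 ℕ.+ k)) ×ᵣ 1# * (ℓ * ℓ ^ᵣ k))) + ℓ ^ᵣ N
        ≈⟨ +-congʳ (+-congˡ (*-congˡ (+-cong (*-congʳ (×ᵣ-congˡ (nC1≡n N))) (∑<-last n _)))) ⟩
      1# + ℓ * (c * 1# + (∑< n (λ k → (N C (2 ℕ.+ k)) ×ᵣ 1# * (ℓ * ℓ ^ᵣ k)) + (N C (2 ℕ.+ n)) ×ᵣ 1# * (ℓ * ℓ ^ᵣ n))) + ℓ ^ᵣ N
        ≈⟨ +-congʳ (+-congˡ (*-congˡ (+-congˡ (+-cong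
             (trans (∑<-cong n (λ k → solve 3 (λ c l p → c :* (l :* p) := l :* (c :* p)) refl ((N C (2 ℕ.+ k)) ×ᵣ 1#) ℓ (ℓ ^ᵣ k))) (sym (*-∑< n ℓ _)))
             (*-congʳ (×ᵣ-congˡ last)))))) ⟩
      1# + ℓ * (c * 1# + (ℓ * S + c * (ℓ * ℓ ^ᵣ n))) + ℓ ^ᵣ N
        ≈⟨ solve 5 (λ l c s p q → con 1 :+ l :* (c :* con 1 :+ (l :* s :+ c :* (l :* p))) :+ q
             := con 1 :+ c :* l :+ l :* (l :* s) :+ c :* (l :* (l :* p)) :+ q) refl ℓ c S (ℓ ^ᵣ n) (ℓ ^ᵣ N) ⟩
      1# + c * ℓ + ℓ * (ℓ * S) + c * ℓ ^ᵣ (2 ℕ.+ n) + ℓ ^ᵣ N ∎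
      where
      N : ℕ
      N = 3 ℕ.+ n
      c S : Carrier
      c = N ×ᵣ 1#
      S = ∑< n (λ k → (N C (2 ℕ.+ k)) ×ᵣ 1# * ℓ ^ᵣ k)
      last : N C (2 ℕ.+ n) ≡.≡ N
      last = ≡.trans (nCk≡nC[n∸k] (ℕ.n≤1+n (2 ℕ.+ n))) (≡.trans (≡.cong (N C_) (ℕ.m+n∸n≡m 1 (2 ℕ.+ n))) (nC1≡n N))

  -- Here e = m + 1, g stands for 1 / (1 - x), and a k is the coefficient of
  -- degree k + 2.
  expand : ∀ m {x A ℓ g t} {a : ℕ → Carrier} → A ≈ 1# + ℓ →
    ℓ * A ^ᵣ suc m + x * ℓ ^ᵣ (3 ℕ.+ m) ≈ x * A ^ᵣ (3 ℕ.+ m) + x * x * g * ℓ ^ᵣ (2 ℕ.+ m) →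
    (∀ k → a k + (suc m C suc k) ×ᵣ 1# ≈ x * ((3 ℕ.+ m) C (2 ℕ.+ k)) ×ᵣ 1#) →
    t + 1# ≈ (3 ℕ.+ m) ×ᵣ 1# * x + x * x * g →
    eval (x ∷ 0# ∷ coefficients m a t) ℓ + (3 ℕ.+ m) ×ᵣ 1# * x * ℓ ≈ ℓ
  expand m {x} {A} {ℓ} {g} {t} {a} A≈ eq a-eq t-eq = ∙-cancelʳ (ℓ * (ℓ * S₂) + ℓ ^ᵣ (2 ℕ.+ m) + x * ℓ ^ᵣ (3 ℕ.+ m)) _ _ (begin
    (x + ℓ * (0# + ℓ * eval (coefficients m a t) ℓ)) + c * x * ℓ + (ℓ * (ℓ * S₂) + p + x * (ℓ * p))
      ≈⟨ +-congʳ (+-congʳ (+-congˡ (*-congˡ (+-congˡ (*-congˡ (eval-coefficients m a t ℓ)))))) ⟩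
    (x + ℓ * (0# + ℓ * (Sa + t * ℓ ^ᵣ m))) + c * x * ℓ + (ℓ * (ℓ * S₂) + p + x * (ℓ * p))
      ≈⟨ solve 7 (λ x l sa t q c s₂ → (x :+ l :* (con 0 :+ l :* (sa :+ t :* q))) :+ c :* x :* l :+ (l :* (l :* s₂) :+ l :* (l :* q) :+ x :* (l :* (l :* (l :* q))))
           := x :+ l :* (l :* (sa :+ s₂)) :+ c :* x :* l :+ (t :+ con 1) :* (l :* (l :* q)) :+ x :* (l :* (l :* (l :* q)))) refl x ℓ Sa t (ℓ ^ᵣ m) c S₂ ⟩
    x + ℓ * (ℓ * (Sa + S₂)) + c * x * ℓ + (t + 1#) * p + x * (ℓ * p)
      ≈⟨ +-congʳ (+-cong (+-congʳ (+-congˡ (*-congˡ (*-congˡ sums)))) (*-congʳ t-eq)) ⟩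
    x + ℓ * (ℓ * (x * S₁)) + c * x * ℓ + (c * x + x * x * g) * p + x * (ℓ * p)
      ≈⟨ solve 6 (λ x l s c g p → x :+ l :* (l :* (x :* s)) :+ c :* x :* l :+ (c :* x :+ x :* x :* g) :* p :+ x :* (l :* p)
           := x :* (con 1 :+ c :* l :+ l :* (l :* s) :+ c :* p :+ l :* p) :+ x :* x :* g :* p) refl x ℓ S₁ c g p ⟩
    x * (1# + c * ℓ + ℓ * (ℓ * S₁) + c * p + ℓ * p) + x * x * g * p
      ≈⟨ +-congʳ (*-congˡ (trans (^-congˡ (3 ℕ.+ m) A≈) (split-2+ ℓ m))) ⟨
    x * A ^ᵣ (3 ℕ.+ m) + x * x * g * p
      ≈⟨ eq ⟨
    ℓ * A ^ᵣ suc m + x * (ℓ * p)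
      ≈⟨ +-congʳ (*-congˡ (trans (^-congˡ (suc m) A≈) (split-1+ ℓ m))) ⟩
    ℓ * (1# + ℓ * S₂ + ℓ ^ᵣ suc m) + x * (ℓ * p)
      ≈⟨ solve 4 (λ l s q r → l :* (con 1 :+ l :* s :+ q) :+ r := l :+ (l :* (l :* s) :+ l :* q :+ r)) refl ℓ S₂ (ℓ ^ᵣ suc m) (x * (ℓ * p)) ⟩
    ℓ + (ℓ * (ℓ * S₂) + p + x * (ℓ * p)) ∎)
    where
    open AbelianGroupProperties +-abelianGroup using (∙-cancelʳ)
    c p S₁ S₂ Sa : Carrier
    c = (3 ℕ.+ m) ×ᵣ 1#
    p = ℓ ^ᵣ (2 ℕ.+ m)
    S₁ = ∑< m (λ k → ((3 ℕ.+ m) C (2 ℕ.+ k)) ×ᵣ 1# * ℓ ^ᵣ k)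
    S₂ = ∑< m (λ k → (suc m C suc k) ×ᵣ 1# * ℓ ^ᵣ k)
    Sa = ∑< m (λ k → a k * ℓ ^ᵣ k)
    sums : Sa + S₂ ≈ x * S₁
    sums = begin
      Sa + S₂
        ≈⟨ ∑<-+ m _ _ ⟨
      ∑< m (λ k → a k * ℓ ^ᵣ k + (suc m C suc k) ×ᵣ 1# * ℓ ^ᵣ k)
        ≈⟨ ∑<-cong m (λ k → trans (sym (distribʳ (ℓ ^ᵣ k) (a k) _)) (trans (*-congʳ (a-eq k)) (*-assoc x _ _))) ⟩
      ∑< m (λ k → x * (((3 ℕ.+ m) C (2 ℕ.+ k)) ×ᵣ 1# * ℓ ^ᵣ k))
        ≈⟨ *-∑< m x _ ⟨
      x * S₁ ∎

-- Existence of the generating functions, and their combinatorial meaning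

-- Power series defined by a recursive equation.
module Recursive (R : CommutativeRing 0ℓ 0ℓ) where
  open CommutativeRing R hiding (zero)
  open Series R
  private module S = CommutativeRing seriesRing

  -- The coefficients of Ψ f up to n depend on those of f up to n only.
  Causal : ((ℕ → Carrier) → ℕ → Carrier) → Set
  Causal Ψ = ∀ n {f g} → (∀ k → k ≤ n → f k ≈ g k) → Ψ f n ≈ Ψ g n

  -- The n-th coefficient is final after n + 1 iterations from 0.
  solution : ∀ Ψ → Causal Ψ → ∃[ f ] f ≋ S.1# S.+ y · Ψ f
  solution Ψ causal = f , eq
    where
    approx : ℕ → ℕ → Carrier
    approx zero    = S.0#
    approx (suc n) = S.1# S.+ shift (Ψ (approx n))
    f : ℕ → Carrier
    f n = approx (suc n) n
    agree : ∀ m n k → k ℕ.< m → k ℕ.< n → approx m k ≈ approx n k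
    agree (suc m) (suc n) zero    _         _         = refl
    agree (suc m) (suc n) (suc k) (s≤s k<m) (s≤s k<n) = +-congˡ (causal k λ j j≤k →
      agree m n j (ℕ.≤-<-trans j≤k k<m) (ℕ.≤-<-trans j≤k k<n))
    eq : f ≋ S.1# S.+ y · Ψ f
    eq zero    = +-congˡ (sym (y-· (Ψ f) 0))
    eq (suc n) = +-congˡ (trans (causal n λ j j≤n → agree (suc n) (suc j) j (s≤s j≤n) ℕ.≤-refl)
                                (sym (y-· (Ψ f) (suc n))))

  module _ (e : ℕ) where
    open GeneratingFunctions seriesRing e y

    -- 1 / (1 - y)
    geometric : ∃[ f ] f ≋ S.1# S.+ y · f
    geometric = solution (λ f → f) (λ n p → p n ℕ.≤-refl)

    private
      Z : (ℕ → Carrier) → ℕ → ℕ → Carrier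
      Z f zero    = proj₁ geometric
      Z f (suc k) = S.1# S.+ y · f · Z f k

      Z-causal : ∀ k → Causal (λ f → Z f k)
      Z-causal zero    n p = refl
      Z-causal (suc k) n p = +-congˡ (·-cong-≤ n
        (λ i i≤n → ·-cong-≤ {y} i (λ _ _ → refl) (λ j j≤i → p j (ℕ.≤-trans j≤i i≤n)))
        (λ i i≤n → Z-causal k i (λ j j≤i → p j (ℕ.≤-trans j≤i i≤n))))

    -- Z is determined by E, so the equation for E involves E alone and is solved
    -- before the one for A.
    system : System
    system = record
      { E = E ; A = A ; Z = Z E
      ; Z-zero = proj₂ geometric
      ; Z-suc = λ k → S.refl {Z E (suc k)}
      ; E-eq = S.trans E-eq (S.+-congˡ {S.1#} (S.sym (S.*-assoc y E (Z E e))))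
      ; A-eq = S.trans A-eq (S.+-congˡ {S.1#} (S.sym (S.*-assoc y E A)))
      }
      where
      E-solution : ∃[ f ] f ≋ S.1# S.+ y · (f · Z f e)
      E-solution = solution (λ f → f · Z f e) (λ n p → ·-cong-≤ n p
        (λ i i≤n → Z-causal e i (λ j j≤i → p j (ℕ.≤-trans j≤i i≤n))))
      open Σ E-solution renaming (proj₁ to E; proj₂ to E-eq)
      A-solution : ∃[ f ] f ≋ S.1# S.+ y · (E · f)
      A-solution = solution (λ f → E · f) (λ n p → ·-cong-≤ {E} n (λ _ _ → refl) p)
      open Σ A-solution renaming (proj₁ to A; proj₂ to A-eq)

    open Mult semiring using () renaming (_×_ to _×ᵣ_; ×-homo-+ to ×ᵣ-homo-+; ×-congˡ to ×ᵣ-congˡ; ×-homo-1 to ×ᵣ-homo-1)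
    open SetoidReasoning setoid

    private
      climb-zero : ∀ b k → climb system 0 b k ≈ κ 1# k
      climb-zero nothing  k = refl
      climb-zero (just _) k = refl

      raised : ∀ s h b {σ} → extend e D (state s h b) ≡.≡ just σ → State.height σ ≡.≡ suc h
      raised D h b ≡.refl = ≡.refl
      raised U h b p with below h b
      raised U h b ≡.refl | true = ≡.refl

    -- Left parts of height h with u steps D have length 2 u + h. The induction
    -- on the length compares the recursion for words with gf-eq: reading U
    -- lowers the height, reading D lowers u.
    extensions-gf : ∀ {n} u s h b → n ≡.≡ u ℕ.+ u ℕ.+ h →
                    extensions e n (just (state s h b)) ×ᵣ 1# ≈ gf system (state s h b) u
    extensions-gf {zero} zero s zero b _ = begin
      1 ×ᵣ 1#                                     ≈⟨ ×ᵣ-homo-1 1# ⟩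
      1#                                          ≈⟨ +-identityʳ 1# ⟨
      1# + 0#                                     ≈⟨ +-cong (climb-zero b 0) (y-· (gf? system (extend e D (state s 0 b))) 0) ⟨
      climb system 0 b 0 + (y · gf? system (extend e D (state s 0 b))) 0  ≈⟨ gf-eq system s 0 b 0 ⟨
      gf system (state s 0 b) 0                   ∎
    extensions-gf {suc n} u s h b eq = begin
      extensions e (suc n) (just σ) ×ᵣ 1#
        ≈⟨ ×ᵣ-congˡ (extensions-step e n (just σ)) ⟩
      (extensions e n (extend e U σ) ℕ.+ extensions e n (extend e D σ)) ×ᵣ 1#
        ≈⟨ ×ᵣ-homo-+ 1# (extensions e n (extend e U σ)) _ ⟩
      extensions e n (extend e U σ) ×ᵣ 1# + extensions e n (extend e D σ) ×ᵣ 1#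
        ≈⟨ +-cong (ascent u h eq) (descent u eq) ⟩
      climb system h b u + (y · gf? system (extend e D σ)) u
        ≈⟨ gf-eq system s h b u ⟨
      gf system σ u ∎
      where
      σ : State
      σ = state s h b
      ascent : ∀ u h → suc n ≡.≡ u ℕ.+ u ℕ.+ h → extensions e n (extend e U (state s h b)) ×ᵣ 1# ≈ climb system h b u
      ascent (suc u) zero    _  = trans (×ᵣ-congˡ (extensions-nothing e n)) (sym (climb-zero b (suc u)))
      ascent u       (suc h) eq = extensions-gf u U h b (ℕ.suc-injective (≡.trans eq (ℕ.+-suc (u ℕ.+ u) h)))
      descent : ∀ u → suc n ≡.≡ u ℕ.+ u ℕ.+ h → extensions e n (extend e D σ) ×ᵣ 1# ≈ (y · gf? system (extend e D σ)) u
      descent u eq with extend e D σ | raised s h b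
      descent zero    eq | nothing | _ = trans (×ᵣ-congˡ (extensions-nothing e n)) (sym (y-· S.0# 0))
      descent (suc u) eq | nothing | _ = trans (×ᵣ-congˡ (extensions-nothing e n)) (sym (y-· S.0# (suc u)))
      descent zero    eq | just (state s′ h′ b′) | r with r ≡.refl
      ... | ≡.refl = trans (×ᵣ-congˡ (extensions-short e n s′ (suc h) b′ (ℕ.m≤n⇒m≤1+n (ℕ.≤-reflexive eq)))) (sym (y-· (gf system (state s′ (suc h) b′)) 0))
      descent (suc u) eq | just (state s′ h′ b′) | r with r ≡.refl
      ... | ≡.refl = trans (extensions-gf u s′ (suc h) b′ (ℕ.suc-injective (≡.trans eq (arith u h)))) (sym (y-· (gf system (state s′ (suc h) b′)) (suc u)))
        where
        arith : ∀ u h → suc u ℕ.+ suc u ℕ.+ h ≡.≡ suc (u ℕ.+ u ℕ.+ suc h)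
        arith u h = ≡.cong suc (≡.trans (≡.cong (ℕ._+ h) (ℕ.+-suc u u)) (≡.sym (ℕ.+-suc (u ℕ.+ u) h)))

-- The identity over the rational numbers

open ≡ using (_≡_; refl; sym; trans; cong; cong₂; subst)

-- FPSring is ℚ[[x]], with variable y; the series over it, ℚ[[x]][[y]], have
-- the variable B.y.
private
  ℚring FPSring : CommutativeRing 0ℓ 0ℓ
  ℚring   = ℚ.+-*-commutativeRing
  FPSring = Series.seriesRing ℚring

  module ℚR = CommutativeRing ℚring
  module P = CommutativeRing FPSring
  module PS = Solver P.commutativeSemiring

open Series ℚring using (κ; κ-·; y; y-·; ·-cong; ·-congˡ; ·-congʳ; ×ₛ-coeff)
open Mult ℚR.semiring using () renaming (_×_ to _×ℚ_)
open Mult P.semiring using () renaming (_×_ to _×ₚ_; ×-assoc-* to ×ₚ-assoc-*; ×-congʳ to ×ₚ-congʳ; ×-congˡ to ×ₚ-congˡ)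
open Exp P.semiring using () renaming (_^_ to _^ₚ_; ^-congˡ to ^ₚ-congˡ)

fromℕ-suc : ∀ n → fromℕ (suc n) ≡ 1ℚ ℚ.+ fromℕ n
fromℕ-suc n = ℚ.toℚᵘ-injective (ℚᵘ.≃-trans (ℚ.toℚᵘ-fromℚᵘ (ℚᵘ.mkℚᵘ (ℤ.+ suc n) 0))
  (ℚᵘ.≃-trans (ℚᵘ.*≡* integers)
  (ℚᵘ.≃-trans (ℚᵘ.+-congʳ (ℚ.toℚᵘ 1ℚ) (ℚᵘ.≃-sym (ℚ.toℚᵘ-fromℚᵘ (ℚᵘ.mkℚᵘ (ℤ.+ n) 0))))
    (ℚᵘ.≃-sym (ℚ.toℚᵘ-homo-+ 1ℚ (fromℕ n))))))
  where
  integers : ℤ.+ suc n ℤ.* ℤ.+ 1 ≡ (ℤ.+ 1 ℤ.* ℤ.+ 1 ℤ.+ ℤ.+ n ℤ.* ℤ.+ 1) ℤ.* ℤ.+ 1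
  integers = cong (ℤ._* ℤ.+ 1) (cong (λ z → ℤ.+ 1 ℤ.+ z) (sym (ℤ.*-identityʳ (ℤ.+ n))))

fromℕ-× : ∀ n → fromℕ n ≡ n ×ℚ 1ℚ
fromℕ-× zero    = refl
fromℕ-× (suc n) = trans (fromℕ-suc n) (cong (1ℚ ℚ.+_) (fromℕ-× n))

×ℚ-cancel : ∀ n {a b} → suc n ×ℚ a ≡ suc n ×ℚ b → a ≡ b
×ℚ-cancel n {a} {b} eq = begin
  a                                  ≡⟨ unscale a ⟨
  ℚ.1/ q ℚ.* (suc n ×ℚ a)            ≡⟨ cong (ℚ.1/ q ℚ.*_) eq ⟩
  ℚ.1/ q ℚ.* (suc n ×ℚ b)            ≡⟨ unscale b ⟩
  b                                  ∎
  where
  open ≡.≡-Reasoning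
  q : ℚ
  q = fromℕ (suc n)
  instance
    q≢0 : ℚ.NonZero q
    q≢0 = ℚ.pos⇒nonZero q {{ℚ.normalize-pos (suc n) 1}}
  unscale : ∀ a → ℚ.1/ q ℚ.* (suc n ×ℚ a) ≡ a
  unscale a = begin
    ℚ.1/ q ℚ.* (suc n ×ℚ a)           ≡⟨ cong (λ z → ℚ.1/ q ℚ.* (suc n ×ℚ z)) (sym (ℚ.*-identityˡ a)) ⟩
    ℚ.1/ q ℚ.* (suc n ×ℚ (1ℚ ℚ.* a))  ≡⟨ cong (ℚ.1/ q ℚ.*_) (sym (Mult.×-assoc-* ℚR.semiring (suc n) 1ℚ a)) ⟩
    ℚ.1/ q ℚ.* ((suc n ×ℚ 1ℚ) ℚ.* a)  ≡⟨ cong (λ z → ℚ.1/ q ℚ.* (z ℚ.* a)) (sym (fromℕ-× (suc n))) ⟩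
    ℚ.1/ q ℚ.* (q ℚ.* a)              ≡⟨ sym (ℚ.*-assoc (ℚ.1/ q) q a) ⟩
    ℚ.1/ q ℚ.* q ℚ.* a                ≡⟨ cong (ℚ._* a) (ℚ.*-inverseˡ q) ⟩
    1ℚ ℚ.* a                          ≡⟨ ℚ.*-identityˡ a ⟩
    a                                 ∎

×ₚ-cancel : ∀ n {f g} → suc n ×ₚ f P.≈ suc n ×ₚ g → f P.≈ g
×ₚ-cancel n {f} {g} eq k = ×ℚ-cancel n (trans (sym (×ₛ-coeff (suc n) f k)) (trans (eq k) (×ₛ-coeff (suc n) g k)))

X≈y : X P.≈ y
X≈y 0             = refl
X≈y 1             = refl
X≈y (suc (suc n)) = refl

const-× : ∀ c → const c P.≈ c ×ₚ P.1#
const-× c zero    = trans (fromℕ-× c) (sym (×ₛ-coeff c P.1# 0))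
const-× c (suc n) = sym (trans (×ₛ-coeff c P.1# (suc n)) (×-zero c))
  where
  ×-zero : ∀ c → c ×ℚ 0ℚ ≡ 0ℚ
  ×-zero zero    = refl
  ×-zero (suc c) = trans (ℚ.+-identityˡ _) (×-zero c)

const-1 : const 1 P.≈ P.1#
const-1 zero    = refl
const-1 (suc n) = refl

const-⊗ : ∀ c f → const c ⊗ f P.≈ c ×ₚ f
const-⊗ c f = P.trans (·-congʳ f (const-× c)) (P.trans (×ₚ-assoc-* c P.1# f) (×ₚ-congʳ c (P.*-identityˡ f)))

^-^ₚ : ∀ f n → f ^ n P.≈ f ^ₚ n
^-^ₚ f zero    = const-1
^-^ₚ f (suc n) = ·-congˡ f (^-^ₚ f n)

-- The order of a series in ℚ[[x]] is twice its usual order.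
filtration : Filtration FPSring
filtration = seriesFiltration 2 (trivialFiltration ℚring)

module F = Filtration filtration
module B = Series FPSring
module S = CommutativeRing B.seriesRing
module SS = Solver S.commutativeSemiring
module G = Filtration (seriesFiltration 1 filtration)
open Lagrange FPSring filtration using (_~[_]_; module Inversion)

variable-order : ∀ {R} w (F : Filtration R) → Filtration.I (seriesFiltration w F) w (Series.y R)
variable-order {R} w F zero          = Filtration.I-0# F w
variable-order {R} w F (suc zero)    = Filtration.I-mono F (ℕ.≤-reflexive (trans (cong (w ∸_) (ℕ.+-identityʳ w)) (ℕ.n∸n≡0 w))) (Filtration.I-all F _)
variable-order {R} w F (suc (suc n)) = Filtration.I-0# F _

κ-order : ∀ {R} w (F : Filtration R) {k a} → Filtration.I F k a → Filtration.I (seriesFiltration w F) k (Series.κ R a)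
κ-order w F a∈ zero    = a∈
κ-order w F a∈ (suc n) = Filtration.I-0# F _

~-coeff : ∀ {f g M} → f ~[ M ] g → ∀ m → m ℕ.* 2 ℕ.< M → f m ≡ g m
~-coeff {f} {g} {M} (u , v , u∈ , v∈ , eq) m m<M = begin
  f m           ≡⟨ ℚ.+-identityʳ (f m) ⟨
  f m ℚ.+ 0ℚ    ≡⟨ cong (f m ℚ.+_) (vanish u∈) ⟨
  f m ℚ.+ u m   ≡⟨ eq m ⟩
  g m ℚ.+ v m   ≡⟨ cong (g m ℚ.+_) (vanish v∈) ⟩
  g m ℚ.+ 0ℚ    ≡⟨ ℚ.+-identityʳ (g m) ⟩
  g m           ∎
  where
  open ≡.≡-Reasoning
  vanish : ∀ {u} → F.I M u → u m ≡ 0ℚ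
  vanish {u} u∈ with M ∸ m ℕ.* 2 | ℕ.m<n⇒0<n∸m m<M | u∈ m
  ... | suc _ | _ | p = p

∑-foldr : ∀ fs → ∑ fs P.≈ foldr P._+_ P.0# fs
∑-foldr []       zero    = refl
∑-foldr []       (suc n) = refl
∑-foldr (f ∷ fs) n       = cong (f n ℚ.+_) (∑-foldr fs n)

module _ where
  open Expansion FPSring using (coefficients)
  open MultinomialTheorem FPSring y using (monomial)

  ∏-monomial : ∀ m (a : ℕ → FPS) t (i : Vec ℕ (suc m)) →
    t ^ (i ⟨ 2 ℕ.+ m ⟩) ⊗ ∏ (applyUpTo (λ l → a l ^ (i ⟨ 2 ℕ.+ l ⟩)) m) P.≈ monomial (coefficients m a t) i
  ∏-monomial zero    a t (k ∷ []) = ·-cong (^-^ₚ t k) const-1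
  ∏-monomial (suc m) a t (k ∷ i)  = P.trans
    (PS.solve 3 (λ t a p → t PS.:* (a PS.:* p) PS.:= a PS.:* (t PS.:* p)) P.refl
      (t ^ (i ⟨ 2 ℕ.+ m ⟩)) (a 0 ^ k) (∏ (applyUpTo (λ l → a (suc l) ^ (i ⟨ 2 ℕ.+ l ⟩)) m)))
    (·-cong (^-^ₚ (a 0) k) (∏-monomial m (λ l → a (suc l)) t i))

weight≡wt : ∀ {m} (i : Vec ℕ m) → weight i ≡ wt 2 i
weight≡wt {m} i = trans (cong sum (map-applyUpTo (2 ℕ.+_) (λ j → j ℕ.* i ⟨ j ⟩) m)) (go i 2 (2 ℕ.+_) (λ _ → refl))
  where
  go : ∀ {m} (i : Vec ℕ m) j (f : ℕ → ℕ) → (∀ l → f l ≡ j ℕ.+ l) → sum (applyUpTo (λ l → f l ℕ.* i ⟨ 2 ℕ.+ l ⟩) m) ≡ wt j i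
  go []      j f eq = refl
  go (k ∷ i) j f eq = cong₂ ℕ._+_ (cong (ℕ._* k) (trans (eq 0) (ℕ.+-identityʳ j)))
    (go i (suc j) (λ l → f (suc l)) (λ l → trans (eq (suc l)) (ℕ.+-suc j l)))

sum≤wt : ∀ {m} j (i : Vec ℕ m) → sum (toList i) ≤ wt (suc j) i
sum≤wt j []      = z≤n
sum≤wt j (k ∷ i) = ℕ.+-mono-≤ (ℕ.m≤m+n k (j ℕ.* k)) (sum≤wt (suc j) i)

multinomial≡multi : ∀ n ks → sum ks ≤ n → multinomial n ks ≡ multi n ks
multinomial≡multi n ks le =
  quotient≡ {{product≢0 (All.map⁺ (All.universal ℕ._!≢0 (n ∸ sum ks ∷ ks)))}} (multi n ks) (multi-factorials n ks le)
  where
  quotient≡ : ∀ {a b} .{{_ : ℕ.NonZero b}} m → m ℕ.* b ≡ a → a ℕ./ b ≡ m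
  quotient≡ {b = b} m refl = m*n/n≡m m b

-- The case d = - e with e = m + 1.
module _ (m : ℕ) where
  private
    e : ℕ
    e = suc m

  open Recursive ℚring using (solution; system; extensions-gf)
  open GeneratingFunctions FPSring e y using (System; module System)
  open System (system e) using (E; A; Z; Z-zero; A-eq)
  module GF = GeneratingFunctions FPSring e y
  open Polynomial FPSring
  open Expansion FPSring using (coefficients; expand)

  -- The generating function of the nonempty d-Dyck paths.
  ℓ : FPS
  ℓ = GF.ℓ (system e)

  L≈ℓ : L -[1+ m ] P.≈ ℓ
  L≈ℓ zero = sym (trans (P.*-assoc y E A 0) (y-· (E ⊗ A) 0))
  L≈ℓ (suc n) = begin
    fromℕ (r -[1+ m ] (suc n))
      ≡⟨ cong fromℕ (r≡extensions m (suc n)) ⟩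
    fromℕ (extensions e (2 ℕ.* suc n) (just initial))
      ≡⟨ fromℕ-× (extensions e (2 ℕ.* suc n) (just initial)) ⟩
    extensions e (2 ℕ.* suc n) (just initial) ×ℚ 1ℚ
      ≡⟨ extensions-gf e (suc n) D 0 nothing (sym (ℕ.+-assoc (suc n) (suc n) 0)) ⟩
    (P.1# ⊗ A) (suc n)
      ≡⟨ P.*-identityˡ A (suc n) ⟩
    A (suc n)
      ≡⟨ A-eq (suc n) ⟩
    0ℚ ℚ.+ ℓ (suc n)
      ≡⟨ ℚ.+-identityˡ (ℓ (suc n)) ⟩
    ℓ (suc n) ∎
    where open ≡.≡-Reasoning

  -- x C(e+2,j) - C(e,j-1) for j = k + 2.
  a : ℕ → FPS
  a k = X ⊗ const ((e ℕ.+ 2) C (2 ℕ.+ k)) ⊖ const (e C suc k)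

  -- The coefficients of degrees 2, …, e + 1.
  as : Vec FPS e
  as = coefficients m a (t e)

  -- The constant e + 2.
  c : FPS
  c = (3 ℕ.+ m) ×ₚ P.1#

  e+2 : e ℕ.+ 2 ≡ 3 ℕ.+ m
  e+2 = ℕ.+-comm e 2

  -- 1 / (1 - (e + 2) x)
  w : FPS
  w = proj₁ (solution (λ f → c ⊗ f) (λ n p → Series.·-cong-≤ ℚring {f = c} n (λ _ _ → refl) p))

  w-eq : w P.≈ P.1# P.+ y ⊗ (c ⊗ w)
  w-eq = proj₂ (solution (λ f → c ⊗ f) (λ n p → Series.·-cong-≤ ℚring {f = c} n (λ _ _ → refl) p))

  open SetoidReasoning P.setoid
  open AbelianGroupProperties P.+-abelianGroup using (∙-cancelʳ)

  a-eq : ∀ k → a k P.+ (e C suc k) ×ₚ P.1# P.≈ y P.* ((3 ℕ.+ m) C (2 ℕ.+ k)) ×ₚ P.1#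
  a-eq k = begin
    (X ⊗ const u P.+ P.- const v) P.+ v ×ₚ P.1#    ≈⟨ P.+-congˡ {X ⊗ const u P.+ P.- const v} (const-× v) ⟨
    (X ⊗ const u P.+ P.- const v) P.+ const v      ≈⟨ P.+-assoc (X ⊗ const u) (P.- const v) (const v) ⟩
    X ⊗ const u P.+ (P.- const v P.+ const v)      ≈⟨ P.+-congˡ {X ⊗ const u} (P.-‿inverseˡ (const v)) ⟩
    X ⊗ const u P.+ P.0#                           ≈⟨ P.+-identityʳ (X ⊗ const u) ⟩
    X ⊗ const u                                    ≈⟨ ·-cong X≈y (const-× u) ⟩
    y ⊗ (u ×ₚ P.1#)                                ≈⟨ ·-congˡ y (×ₚ-congˡ {P.1#} (cong (_C (2 ℕ.+ k)) e+2)) ⟩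
    y ⊗ (((3 ℕ.+ m) C (2 ℕ.+ k)) ×ₚ P.1#)          ∎
    where
    u v : ℕ
    u = (e ℕ.+ 2) C (2 ℕ.+ k)
    v = e C suc k

  const-e+2 : const (e ℕ.+ 2) P.≈ c
  const-e+2 = P.trans (const-× (e ℕ.+ 2)) (×ₚ-congˡ {P.1#} e+2)

  -- t = (e + 2) x - 1 + x² / (1 - x)
  t-eq : t e P.+ P.1# P.≈ c ⊗ y P.+ y ⊗ y ⊗ Z 0
  t-eq = ∙-cancelʳ (y ⊗ g) _ _ (begin
    t e P.+ P.1# P.+ y ⊗ g
      ≈⟨ P.+-assoc (t e) P.1# (y ⊗ g) ⟩
    t e P.+ (P.1# P.+ y ⊗ g)
      ≈⟨ P.+-congˡ {t e} Z-zero ⟨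
    t e P.+ g
      ≈⟨ P.+-congʳ {g} (P.*-identityʳ (t e)) ⟨
    t e ⊗ P.1# P.+ g
      ≈⟨ P.+-congʳ {g} (·-congˡ (t e) d⊗g) ⟨
    t e ⊗ (d ⊗ g) P.+ g
      ≈⟨ PS.solve 3 (λ t d g → t PS.:* (d PS.:* g) PS.:+ g PS.:= (t PS.:* d PS.:+ PS.con 1) PS.:* g) P.refl (t e) d g ⟩
    (t e ⊗ d P.+ P.1#) ⊗ g
      ≈⟨ ·-congʳ g (P.+-congʳ {P.1#} (⊘-⊗ (u ⊖ const 1 ⊕ v) d)) ⟩
    ((u ⊖ const 1 ⊕ v) P.+ P.1#) ⊗ g
      ≈⟨ ·-congʳ g numerator+1 ⟩
    (c ⊗ y ⊗ d P.+ y ⊗ (P.1# P.+ y)) ⊗ g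
      ≈⟨ PS.solve 4 (λ c y d g → (c PS.:* y PS.:* d PS.:+ y PS.:* (PS.con 1 PS.:+ y)) PS.:* g
           PS.:= c PS.:* y PS.:* (d PS.:* g) PS.:+ y PS.:* y PS.:* g PS.:+ y PS.:* g) P.refl c y d g ⟩
    c ⊗ y ⊗ (d ⊗ g) P.+ y ⊗ y ⊗ g P.+ y ⊗ g
      ≈⟨ P.+-congʳ {y ⊗ g} (P.+-congʳ {y ⊗ y ⊗ g} (P.trans (·-congˡ (c ⊗ y) d⊗g) (P.*-identityʳ (c ⊗ y)))) ⟩
    c ⊗ y P.+ y ⊗ y ⊗ g P.+ y ⊗ g ∎)
    where
    g d u v : FPS
    g = Z 0
    d = const 1 ⊖ X
    u = const (e ℕ.+ 2) ⊗ X ⊗ d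
    v = X ⊗ (const 1 ⊕ X)
    d+y : d P.+ y P.≈ P.1#
    d+y = P.trans (P.+-congˡ {d} (P.sym {X} X≈y)) (P.trans (P.+-assoc (const 1) (P.- X) X)
      (P.trans (P.+-congˡ {const 1} (P.-‿inverseˡ X)) (P.trans (P.+-identityʳ (const 1)) const-1)))
    d⊗g : d ⊗ g P.≈ P.1#
    d⊗g = ∙-cancelʳ (y ⊗ g) _ _ (begin
      d ⊗ g P.+ y ⊗ g   ≈⟨ P.distribʳ g d y ⟨
      (d P.+ y) ⊗ g     ≈⟨ ·-congʳ g d+y ⟩
      P.1# ⊗ g          ≈⟨ P.*-identityˡ g ⟩
      g                 ≈⟨ Z-zero ⟩
      P.1# P.+ y ⊗ g    ∎)
    numerator+1 : (u ⊖ const 1 ⊕ v) P.+ P.1# P.≈ c ⊗ y ⊗ d P.+ y ⊗ (P.1# P.+ y)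
    numerator+1 = begin
      (u P.+ P.- const 1 P.+ v) P.+ P.1#    ≈⟨ P.+-congˡ {u P.+ P.- const 1 P.+ v} const-1 ⟨
      (u P.+ P.- const 1 P.+ v) P.+ const 1
        ≈⟨ PS.solve 4 (λ u n v o → (u PS.:+ n PS.:+ v) PS.:+ o PS.:= (n PS.:+ o) PS.:+ (u PS.:+ v)) P.refl u (P.- const 1) v (const 1) ⟩
      (P.- const 1 P.+ const 1) P.+ (u P.+ v)   ≈⟨ P.+-congʳ {u P.+ v} (P.-‿inverseˡ (const 1)) ⟩
      P.0# P.+ (u P.+ v)                    ≈⟨ P.+-identityˡ (u P.+ v) ⟩
      u P.+ v                               ≈⟨ P.+-cong {u} (·-congʳ d (·-cong const-e+2 X≈y))
                                                 (·-cong X≈y (P.+-cong {const 1} const-1 X≈y)) ⟩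
      c ⊗ y ⊗ d P.+ y ⊗ (P.1# P.+ y)        ∎

  -- The polynomial whose value at ℓ is (1 - (e + 2) x) ℓ.
  p : Vec FPS (2 ℕ.+ e)
  p = y ∷ P.0# ∷ as

  eval-p : eval p ℓ P.+ c ⊗ y ⊗ ℓ P.≈ ℓ
  eval-p = expand m {y} {A} {ℓ} {Z 0} {t e} {a} A-eq (GF.functional-equation (system e)) a-eq t-eq

  w-eval : w ⊗ eval p ℓ P.≈ ℓ
  w-eval = ∙-cancelʳ (y ⊗ (c ⊗ w) ⊗ ℓ) _ _ (begin
    w ⊗ v P.+ y ⊗ (c ⊗ w) ⊗ ℓ
      ≈⟨ PS.solve 5 (λ w v y c l → w PS.:* v PS.:+ y PS.:* (c PS.:* w) PS.:* l PS.:= w PS.:* (v PS.:+ c PS.:* y PS.:* l)) P.refl w v y c ℓ ⟩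
    w ⊗ (v P.+ c ⊗ y ⊗ ℓ)
      ≈⟨ ·-congˡ w eval-p ⟩
    w ⊗ ℓ
      ≈⟨ ·-congʳ ℓ w-eq ⟩
    (P.1# P.+ y ⊗ (c ⊗ w)) ⊗ ℓ
      ≈⟨ P.distribʳ ℓ P.1# (y ⊗ (c ⊗ w)) ⟩
    P.1# ⊗ ℓ P.+ y ⊗ (c ⊗ w) ⊗ ℓ
      ≈⟨ P.+-congʳ {y ⊗ (c ⊗ w) ⊗ ℓ} (P.*-identityˡ ℓ) ⟩
    ℓ P.+ y ⊗ (c ⊗ w) ⊗ ℓ ∎)
    where
    v : FPS
    v = eval p ℓ

  -- φ = w p satisfies φ(ℓ) = ℓ, and q is the quotient of φ - ℓ by y - ℓ.
  φ q : ℕ → FPS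
  φ = B.κ w B.· poly p
  q = B.κ w B.· quotient p ℓ

  y∈ : F.I 2 y
  y∈ = variable-order 2 (trivialFiltration ℚring)

  ℓ∈ : F.I 1 ℓ
  ℓ∈ = F.I-mono {a = ℓ} (s≤s z≤n) (F.I-* {a = y ⊗ E} {b = A} (F.I-* {a = y} {b = E} y∈ (F.I-all E)) (F.I-all A))

  -- The coefficient of degree 1 of p is 0, so (p - x) / y has order 1.
  tail∈ : G.I 1 (poly (P.0# ∷ as))
  tail∈ = G.I-+ (κ-order 1 filtration (F.I-0# 1))
    (G.I-* {a = B.y} {b = poly as} (variable-order 1 filtration) (G.I-all (poly as)))

  φ∈ : G.I 2 φ
  φ∈ = G.I-* {a = B.κ w} {b = poly p} (G.I-all (B.κ w)) (G.I-+ (κ-order 1 filtration y∈)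
    (G.I-* {a = B.y} {b = poly (P.0# ∷ as)} (variable-order 1 filtration) tail∈))

  q∈ : G.I 1 q
  q∈ = G.I-* {a = B.κ w} {b = quotient p ℓ} (G.I-all (B.κ w)) (G.I-+ tail∈
    (G.I-* {a = B.κ ℓ} {b = quotient (P.0# ∷ as) ℓ} (κ-order 1 filtration ℓ∈) (G.I-all (quotient (P.0# ∷ as) ℓ))))

  φ-ℓ : φ S.+ B.κ ℓ B.· q S.≈ B.κ ℓ S.+ B.y B.· q
  φ-ℓ = S.trans (SS.solve 4 (λ w p l q → w SS.:* p SS.:+ l SS.:* (w SS.:* q) SS.:= w SS.:* (p SS.:+ l SS.:* q)) S.refl (B.κ w) (poly p) (B.κ ℓ) (quotient p ℓ))
    (S.trans (B.·-congˡ (B.κ w) (quotient-eq p ℓ))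
    (S.trans (SS.solve 4 (λ w v y q → w SS.:* (v SS.:+ y SS.:* q) SS.:= w SS.:* v SS.:+ y SS.:* (w SS.:* q)) S.refl (B.κ w) (B.κ (eval p ℓ)) B.y (quotient p ℓ))
      (S.+-congʳ {B.y B.· q} (S.trans (S.sym {B.κ (w ⊗ eval p ℓ)} (κ-* w (eval p ℓ))) (κ-cong w-eval)))))

  open Inversion ×ₚ-cancel {φ} φ∈ {ℓ} ℓ∈ {q} q∈ φ-ℓ using (inversion)

  open Exp S.semiring using () renaming (_^_ to _^ₛ_)
  open MultinomialTheorem FPSring y using (coefficient; monomial; multinomialTheorem; κ-^)
  open ListSum FPSring
  open RangeSum FPSring using (∑<)

  term≈coefficient : ∀ {k} (i : Vec ℕ e) → weight i ≡ k → term (suc k) i P.≈ coefficient (suc k) as i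
  term≈coefficient {k} i weight≡k = begin
    const M ⊗ X ^ n₀ ⊗ t e ^ (i ⟨ suc e ⟩) ⊗ ∏ (map (λ j → b j ^ (i ⟨ j ⟩)) (2 ⋯ e))
      ≈⟨ P.*-assoc (const M ⊗ X ^ n₀) (t e ^ (i ⟨ suc e ⟩)) _ ⟩
    const M ⊗ X ^ n₀ ⊗ (t e ^ (i ⟨ suc e ⟩) ⊗ ∏ (map (λ j → b j ^ (i ⟨ j ⟩)) (2 ⋯ e)))
      ≡⟨ cong (λ fs → const M ⊗ X ^ n₀ ⊗ (t e ^ (i ⟨ suc e ⟩) ⊗ ∏ fs)) (map-applyUpTo (2 ℕ.+_) (λ j → b j ^ (i ⟨ j ⟩)) m) ⟩
    const M ⊗ X ^ n₀ ⊗ (t e ^ (i ⟨ suc e ⟩) ⊗ ∏ (applyUpTo (λ l → a l ^ (i ⟨ 2 ℕ.+ l ⟩)) m))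
      ≈⟨ ·-cong (·-congˡ (const M) (P.trans (^-^ₚ X n₀) (^ₚ-congˡ n₀ X≈y))) (∏-monomial m a (t e) i) ⟩
    const M ⊗ y ^ₚ n₀ ⊗ monomial as i
      ≈⟨ P.*-assoc (const M) (y ^ₚ n₀) (monomial as i) ⟩
    const M ⊗ (y ^ₚ n₀ ⊗ monomial as i)
      ≈⟨ const-⊗ M (y ^ₚ n₀ ⊗ monomial as i) ⟩
    M ×ₚ (y ^ₚ n₀ ⊗ monomial as i)
      ≈⟨ ×ₚ-congˡ {y ^ₚ n₀ ⊗ monomial as i} (multinomial≡multi (suc k) (toList i)
           (ℕ.m≤n⇒m≤1+n (ℕ.≤-trans (sum≤wt 1 i) (ℕ.≤-reflexive (trans (sym (weight≡wt i)) weight≡k))))) ⟩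
    coefficient (suc k) as i ∎
    where
    n₀ M : ℕ
    n₀ = suc k ∸ sum (toList i)
    M = multinomial (suc k) (toList i)
    b : ℕ → FPS
    b j = X ⊗ const ((e ℕ.+ 2) C j) ⊖ const (e C (j ∸ 1))

  terms≈coefficients : ∀ k (is : List (Vec ℕ e)) →
    ∑ (map (term (suc k)) (filter (λ i → weight i ℕ.≟ k) is)) P.≈
    ∑∈ (filter (λ i → wt 2 i ℕ.≟ k) is) (coefficient (suc k) as)
  terms≈coefficients k is = begin
    ∑ (map (term (suc k)) (filter (λ i → weight i ℕ.≟ k) is))
      ≈⟨ ∑-foldr (map (term (suc k)) (filter (λ i → weight i ℕ.≟ k) is)) ⟩
    ∑∈ (filter (λ i → weight i ℕ.≟ k) is) (term (suc k))
      ≈⟨ ∑∈-filter (λ i → weight i ℕ.≟ k) is (term (suc k)) ⟩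
    ∑∈ is (λ i → if does (weight i ℕ.≟ k) then term (suc k) i else P.0#)
      ≈⟨ ∑∈-cong is same ⟩
    ∑∈ is (λ i → if does (wt 2 i ℕ.≟ k) then coefficient (suc k) as i else P.0#)
      ≈⟨ ∑∈-filter (λ i → wt 2 i ℕ.≟ k) is (coefficient (suc k) as) ⟨
    ∑∈ (filter (λ i → wt 2 i ℕ.≟ k) is) (coefficient (suc k) as) ∎
    where
    same : ∀ i → (if does (weight i ℕ.≟ k) then term (suc k) i else P.0#) P.≈
                 (if does (wt 2 i ℕ.≟ k) then coefficient (suc k) as i else P.0#)
    same i = subst (λ v → (if does (weight i ℕ.≟ k) then term (suc k) i else P.0#) P.≈
                          (if does (v ℕ.≟ k) then coefficient (suc k) as i else P.0#))
      (weight≡wt i) (choose (weight i ℕ.≟ k) (term≈coefficient i))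
      where
      choose : ∀ {P : Set} (P? : Dec P) {f g} → (P → f P.≈ g) →
               (if does P? then f else P.0#) P.≈ (if does P? then g else P.0#)
      choose (yes p) f≈g = f≈g p
      choose (no _)  f≈g = P.refl

  numerator≈coeff : ∀ k → numerator e (suc k) P.≈ (poly p ^ₛ suc k) k
  numerator≈coeff k = P.trans (terms≈coefficients k (tuples (upTo (suc k)) e))
    (P.trans (P.sym (multinomialTheorem as 1 (suc k) ℕ.≤-refl))
      (Exp.^-congˡ S.semiring (suc k) horner k))
    where
    horner : B.κ y S.+ B.y ^ₛ 2 B.· poly as S.≈ poly p
    horner = S.trans (SS.solve 3 (λ x y p → x SS.:+ y SS.:* (y SS.:* SS.con 1) SS.:* p SS.:= x SS.:+ y SS.:* (SS.con 0 SS.:+ y SS.:* p)) S.refl (B.κ y) B.y (poly as))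
      (S.+-congˡ {B.κ y} (B.·-congˡ B.y (S.+-congʳ {B.y B.· poly as} {S.0#} {B.κ P.0#} λ { zero → P.refl ; (suc _) → P.refl })))

  -- The denominators cancel against the powers of w.
  w⊗b : w ⊗ (const 1 ⊖ const (e ℕ.+ 2) ⊗ X) P.≈ P.1#
  w⊗b = ∙-cancelʳ (y ⊗ (c ⊗ w)) _ _ (begin
    w ⊗ b P.+ y ⊗ (c ⊗ w)          ≈⟨ PS.solve 4 (λ w b y c → w PS.:* b PS.:+ y PS.:* (c PS.:* w) PS.:= w PS.:* (b PS.:+ c PS.:* y)) P.refl w b y c ⟩
    w ⊗ (b P.+ c ⊗ y)              ≈⟨ ·-congˡ w b+cy ⟩
    w ⊗ P.1#                       ≈⟨ P.*-identityʳ w ⟩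
    w                              ≈⟨ w-eq ⟩
    P.1# P.+ y ⊗ (c ⊗ w)           ∎)
    where
    b : FPS
    b = const 1 ⊖ const (e ℕ.+ 2) ⊗ X
    b+cy : b P.+ c ⊗ y P.≈ P.1#
    b+cy = begin
      b P.+ c ⊗ y                           ≈⟨ P.+-congˡ {b} (·-cong const-e+2 X≈y) ⟨
      b P.+ const (e ℕ.+ 2) ⊗ X             ≈⟨ P.+-assoc (const 1) (P.- (const (e ℕ.+ 2) ⊗ X)) (const (e ℕ.+ 2) ⊗ X) ⟩
      const 1 P.+ (P.- (const (e ℕ.+ 2) ⊗ X) P.+ const (e ℕ.+ 2) ⊗ X)
                                            ≈⟨ P.+-congˡ {const 1} (P.-‿inverseˡ (const (e ℕ.+ 2) ⊗ X)) ⟩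
      const 1 P.+ P.0#                      ≈⟨ P.+-identityʳ (const 1) ⟩
      const 1                               ≈⟨ const-1 ⟩
      P.1#                                  ∎

  summand-eq : ∀ k → suc k ×ₚ summand e (suc k) P.≈ (φ ^ₛ suc k) k
  summand-eq k = begin
    n ×ₚ s
      ≈⟨ ×ₚ-congʳ n (P.trans (P.sym (P.*-identityʳ s)) (·-congˡ s (P.sym wbⁿ))) ⟩
    n ×ₚ (s ⊗ (w ^ₚ n ⊗ b ^ₚ n))
      ≈⟨ const-⊗ n (s ⊗ (w ^ₚ n ⊗ b ^ₚ n)) ⟨
    const n ⊗ (s ⊗ (w ^ₚ n ⊗ b ^ₚ n))
      ≈⟨ PS.solve 4 (λ c s w b → c PS.:* (s PS.:* (w PS.:* b)) PS.:= w PS.:* (s PS.:* (c PS.:* b))) P.refl (const n) s (w ^ₚ n) (b ^ₚ n) ⟩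
    w ^ₚ n ⊗ (s ⊗ (const n ⊗ b ^ₚ n))
      ≈⟨ ·-congˡ (w ^ₚ n) (·-congˡ s (·-congˡ (const n) (^-^ₚ b n))) ⟨
    w ^ₚ n ⊗ (s ⊗ denominator e n)
      ≈⟨ ·-congˡ (w ^ₚ n) (⊘-⊗ (numerator e n) (denominator e n) {{denominator-nonZero e n}}) ⟩
    w ^ₚ n ⊗ numerator e n
      ≈⟨ ·-congˡ (w ^ₚ n) (numerator≈coeff k) ⟩
    w ^ₚ n ⊗ (poly p ^ₛ n) k
      ≈⟨ B.κ-· (w ^ₚ n) (poly p ^ₛ n) k ⟨
    (B.κ (w ^ₚ n) B.· poly p ^ₛ n) k
      ≈⟨ B.·-congʳ (poly p ^ₛ n) (κ-^ w n) k ⟨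
    (B.κ w ^ₛ n B.· poly p ^ₛ n) k
      ≈⟨ CommutativeExp.^-distrib-* S.commutativeSemiring (B.κ w) (poly p) n k ⟨
    (φ ^ₛ n) k ∎
    where
    n : ℕ
    n = suc k
    s b : FPS
    s = summand e n
    b = const 1 ⊖ const (e ℕ.+ 2) ⊗ X
    wbⁿ : w ^ₚ n ⊗ b ^ₚ n P.≈ P.1#
    wbⁿ = P.trans (P.sym (CommutativeExp.^-distrib-* P.commutativeSemiring w b n))
      (P.trans (^ₚ-congˡ n w⊗b) (1^ n))
      where
      1^ : ∀ n → P.1# ^ₚ n P.≈ P.1#
      1^ zero    = P.refl
      1^ (suc n) = P.trans (P.*-identityˡ (P.1# ^ₚ n)) (1^ n)

  -- In degree k, congruence modulo order 2 k + 1 is equality.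
  summands-sum : (λ k → summand e (suc k)) SumsTo L -[1+ m ]
  summands-sum k = suc (k ℕ.* 2) , λ M k<M →
    trans (∑-foldr (applyUpTo summands M) k)
      (trans (~-coeff {∑< M summands} {ℓ} (inversion {summands} summand-eq M) k k<M) (sym (L≈ℓ k)))
    where
    summands : ℕ → FPS
    summands k = summand e (suc k)

theorem2p3 : (d : ℤ) → d < 0ℤ → (λ k → summand ∣ d ∣ (suc k)) SumsTo L d
theorem2p3 (ℤ.+ n)  (ℤ.+<+ ())
theorem2p3 -[1+ m ] _ = summands-sum m
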